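{- Let $X$ be a fan with at least three vertices, and let $G$ be a graph. If $G$ is $X$-minor-free, then $\operatorname{ltd}(G)\leq \binom{|V(X)|-1}{2}$.
   Context: All graphs are finite and simple; the null graph is allowed. A fan is a graph that becomes a path (possibly null) after deleting at most one vertex. A model of $H$ in $G$ is a family $(B_x\mid x\in V(H))$ of pairwise disjoint subsets of $V(G)$ such that each $G[B_x]$ is non-empty and connected, and for every edge $xy\in E(H)$ there is an edge of $G$ between $B_x$ and $B_y$; $G$ is $H$-minor-free if it has no model of $H$. A rooted forest is a disjoint union of rooted trees; its closure is the graph on the same vertex set in which $v\neq w$ are adjacent iff one is an ancestor of the other. An elimination forest of $G$ is a rooted forest $F$ with $V(F)=V(G)$ such that $G$ is a subgraph of the closure of $F$. A layering of $G$ is a sequence $(L_i\mid i\geq 0)$ of pairwise disjoint subsets of $V(G)$ with union $V(G)$ such that every edge has both ends in $L_i\cup L_{i+1}$ for some $i$. The width of a pair $(F,(L_i))$ is $\max\{|V(R)\cap L_i| : R \text{ a root-to-leaf path in } F,\ i\ge 0\}$. The layered treedepth $\operatorname{ltd}(G)$ is the minimum width of such a pair, over elimination forests $F$ of $G$ and layerings of $G$. -}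

module Defs where

open import Data.Nat using (ℕ; zero; suc; _≤_)
open import Data.Fin using (Fin; toℕ)
open import Data.Bool using (Bool; true; false)
open import Data.Maybe using (Maybe; just; nothing)
open import Data.Product using (Σ; _×_; _,_; ∃)
open import Data.Sum using (_⊎_)
open import Data.Empty using (⊥)
open import Relation.Nullary using (¬_)
open import Relation.Binary.PropositionalEquality using (_≡_; _≢_)
open import Function.Definitions using (Injective)

record Graph : Set where
  field
    size  : ℕ
    adj   : Fin size → Fin size → Bool
    sym   : ∀ u v → adj u v ≡ adj v u
    irrefl : ∀ v → adj v v ≡ false

open Graph public

Edge : (G : Graph) → Fin (size G) → Fin (size G) → Set
Edge G u v = adj G u v ≡ true

VSet : Graph → Set₁
VSet G = Fin (size G) → Set

AtMost : {n : ℕ} → (Fin n → Set) → ℕ → Set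
AtMost {n} S k = (f : Fin (suc k) → Fin n) → Injective _≡_ _≡_ f → ¬ (∀ j → S (f j))

IndPath : (G : Graph) → VSet G → Set
IndPath G S = Σ ℕ λ k → Σ (Fin k → Fin (size G)) λ σ →
    Injective _≡_ _≡_ σ
  × (∀ i → S (σ i))
  × (∀ x → S x → ∃ λ i → σ i ≡ x)
  × (∀ i j → (Edge G (σ i) (σ j) → (suc (toℕ i) ≡ toℕ j ⊎ suc (toℕ j) ≡ toℕ i))
           × ((suc (toℕ i) ≡ toℕ j ⊎ suc (toℕ j) ≡ toℕ i) → Edge G (σ i) (σ j)))

IsFan : Graph → Set
IsFan X = IndPath X (λ _ → Data.Unit.⊤) ⊎ (∃ λ v → IndPath X (λ x → x ≢ v))
  where import Data.Unit

data Reach (G : Graph) (S : VSet G) (u : Fin (size G)) : Fin (size G) → Set where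
  here : S u → Reach G S u u
  step : ∀ {w v} → Reach G S u w → S v → Edge G w v → Reach G S u v

record Model (H G : Graph) : Set₁ where
  field
    branch    : Fin (size H) → VSet G
    disjoint  : ∀ x y → x ≢ y → ∀ v → branch x v → branch y v → ⊥
    nonempty  : ∀ x → ∃ λ v → branch x v
    connected : ∀ x u v → branch x u → branch x v → Reach G (branch x) u v
    edges     : ∀ x y → Edge H x y →
                ∃ λ u → ∃ λ v → branch x u × branch y v × Edge G u v

MinorFree : Graph → Graph → Set₁
MinorFree H G = ¬ Model H G

-- A rooted forest on Fin n given by a parent map (nothing = root).
-- ProperAnc p v w : w is a proper ancestor of v.
data ProperAnc {n : ℕ} (p : Fin n → Maybe (Fin n)) (v : Fin n) : Fin n → Set where
  par  : ∀ {w} → p v ≡ just w → ProperAnc p v w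
  up   : ∀ {u w} → p v ≡ just u → ProperAnc p u w → ProperAnc p v w

record RootedForest (n : ℕ) : Set where
  field
    parent  : Fin n → Maybe (Fin n)
    acyclic : ∀ v → ¬ ProperAnc parent v v

open RootedForest public

IsLeaf : {n : ℕ} → RootedForest n → Fin n → Set
IsLeaf F v = ∀ w → parent F w ≢ just v

OnRootPath : {n : ℕ} → RootedForest n → Fin n → Fin n → Set
OnRootPath F v w = w ≡ v ⊎ ProperAnc (parent F) v w

IsEliminationForest : (G : Graph) → RootedForest (size G) → Set
IsEliminationForest G F = ∀ u v → Edge G u v →
  ProperAnc (parent F) u v ⊎ ProperAnc (parent F) v u

-- A layering, given as the map sending each vertex to the index of its layer.
IsLayering : (G : Graph) → (Fin (size G) → ℕ) → Set
IsLayering G L = ∀ u v → Edge G u v → (L u ≤ suc (L v)) × (L v ≤ suc (L u))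

WidthAtMost : (G : Graph) → RootedForest (size G) → (Fin (size G) → ℕ) → ℕ → Set
WidthAtMost G F L k = ∀ v → IsLeaf F v → ∀ i →
  AtMost (λ w → OnRootPath F v w × L w ≡ i) k

LtdAtMost : Graph → ℕ → Set
LtdAtMost G k = Σ (RootedForest (size G)) λ F → Σ (Fin (size G) → ℕ) λ L →
  IsEliminationForest G F × IsLayering G L × WidthAtMost G F L k

module Submission where

open import Defs hiding (sym; irrefl)
open import Data.Nat as ℕ using (ℕ; zero; suc; _+_; _∸_; _≤_; _<_; z≤n; s≤s)
open import Data.Nat.Properties hiding (_≟_)
open import Data.Nat.Combinatorics using (_C_; nCk+nC[k+1]≡[n+1]C[k+1]; nC1≡n)
import Data.Bool.Properties as Bool
open import Data.Bool using (true)
open import Data.Fin using (Fin; zero; suc; toℕ; fromℕ<; inject≤; punchOut)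
open import Data.Fin.Properties as Fin
  using (_≟_; any?; injective⇒≤; inject≤-injective; punchOut-injective)
open import Data.List
  using (List; []; _∷_; _++_; _ʳ++_; length; filter; allFin; lookup; concat; cartesianProduct)
open import Data.List.Properties
  using (length-filter; length-tabulate; length-ʳ++; filter-accept; filter-reject; filter-none;
         filter-notAll)
open import Data.List.Membership.Propositional using (_∈_; _∉_; find)
open import Data.List.Membership.Propositional.Properties
open import Data.List.Relation.Unary.All as All using (All; []; _∷_)
open import Data.List.Relation.Unary.AllPairs using (AllPairs; []; _∷_)
open import Data.List.Relation.Unary.Any as Any using (here; there)
open import Data.List.Relation.Unary.Any.Properties using (lookup-index)
open import Data.List.Relation.Unary.Linked as Linked using (Linked; []; [-]; _∷_)
open import Data.List.Relation.Unary.Unique.Propositional using (Unique)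
import Data.List.Relation.Unary.Unique.Propositional.Properties as Unique
open import Data.Maybe using (Maybe; just; nothing)
open import Data.Product as Product using (Σ; ∃-syntax; _×_; _,_; proj₁; proj₂)
open import Data.Product.Properties using (≡-dec)
open import Data.Sum as Sum using (_⊎_; inj₁; inj₂; [_,_]′; swap)
open import Data.Empty using (⊥; ⊥-elim)
open import Data.Unit using (⊤; tt)
open import Function using (_∘_; id; case_of_)
open import Function.Definitions using (Injective)
open import Relation.Nullary using (¬_; Dec; yes; no; ¬?; contradiction)
open import Relation.Nullary.Decidable using (_×-dec_; _⊎-dec_; map′; decidable-stable)
open import Relation.Binary.PropositionalEquality

-- Let k = |X| - 1, so that X lies in the fan with k rim vertices.  If U is connected and D is a
-- connected set disjoint from U, then D has no chain of k disjoint connected branches, consecutive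
-- ones adjacent, each meeting S = N(U) ∩ D: with U as centre it would give a model of X.
--
-- Claim: without such a chain, S is covered by an elimination tree of depth C(k,2).  By induction
-- on k it suffices to find k - 1 vertices meeting every (k-1)-chain of D.  Two disjoint
-- (k-1)-chains could be joined through their longer halves to a k-chain, so any two of them
-- intersect, and hence some path Q meets them all.  By Menger's theorem either k disjoint S-Q
-- paths cut Q into a k-chain, or some k - 1 vertices separate S from Q; as every chain meets both
-- S and Q, these vertices meet every chain.
--
-- The vertices of that tree form the next layer.  Every component D′ that is left over is treated
-- in the same way, with the component of G - D′ that contains U in the role of U.  This needs all
-- neighbours of D′ to lie in that component; a part K of D that only hangs off D′ is put back
-- into D′, which leaves fewer vertices in the tree.

-- Vertex sets as lists, and their sizes

infix 4 _∈?_

_∈?_ : ∀ {n} (x : Fin n) xs → Dec (x ∈ xs)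
x ∈? xs = Any.any? (x ≟_) xs

module _ {A : Set} {P Q : A → Set} (P? : ∀ x → Dec (P x)) (Q? : ∀ x → Dec (Q x))
         (P⇒Q : ∀ {x} → P x → Q x) where

  filter-≤ : ∀ xs → length (filter P? xs) ≤ length (filter Q? xs)
  filter-≤ [] = z≤n
  filter-≤ (x ∷ xs) with P? x | Q? x
  ... | yes _ | yes _ = s≤s (filter-≤ xs)
  ... | yes p | no ¬q = contradiction (P⇒Q p) ¬q
  ... | no _  | yes _ = m≤n⇒m≤1+n (filter-≤ xs)
  ... | no _  | no _  = filter-≤ xs

  filter-< : ∀ {xs x} → x ∈ xs → ¬ P x → Q x → length (filter P? xs) < length (filter Q? xs)
  filter-< {x ∷ xs} (here refl) ¬p q with P? x | Q? x
  ... | yes p | _     = contradiction p ¬p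
  ... | no _  | yes _ = s≤s (filter-≤ xs)
  ... | no _  | no ¬q = contradiction q ¬q
  filter-< {x ∷ xs} (there x∈) ¬p q with P? x | Q? x
  ... | yes _ | yes _ = s≤s (filter-< x∈ ¬p q)
  ... | yes p | no ¬q = contradiction (P⇒Q p) ¬q
  ... | no _  | yes _ = m≤n⇒m≤1+n (filter-< x∈ ¬p q)
  ... | no _  | no _  = filter-< x∈ ¬p q

-- Lists stand for sets and may repeat elements. Counting through `allFin` ignores repetitions, so
-- the count is bounded by `n`.
card : ∀ {n} → List (Fin n) → ℕ
card xs = length (filter (_∈? xs) (allFin _))

card≤n : ∀ {n} (xs : List (Fin n)) → card xs ≤ n
card≤n {n} xs = ≤-trans (length-filter (_∈? xs) (allFin n)) (≤-reflexive (length-tabulate id))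

card-< : ∀ {n} {xs ys : List (Fin n)} {x} → (∀ {z} → z ∈ xs → z ∈ ys) → x ∉ xs → x ∈ ys →
         card xs < card ys
card-< {xs = xs} {ys} xs⊆ys x∉ x∈ = filter-< (_∈? xs) (_∈? ys) xs⊆ys (∈-allFin _) x∉ x∈

-- Walks, their first entry into a set, and closures

data Walk {V : Set} (E : V → V → Set) (P : V → Set) : V → V → Set where
  stop : ∀ {u} → P u → Walk E P u u
  go   : ∀ {u w v} → P u → E u w → Walk E P w v → Walk E P u v

module _ {V : Set} where

  walk-map : ∀ {E E′ : V → V → Set} {P P′ : V → Set} → (∀ {u v} → E u v → E′ u v) →
             (∀ {v} → P v → P′ v) → ∀ {u v} → Walk E P u v → Walk E′ P′ u v
  walk-map f g (stop p)   = stop (g p)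
  walk-map f g (go p e w) = go (g p) (f e) (walk-map f g w)

  widen : ∀ {E : V → V → Set} {P P′ : V → Set} → (∀ {v} → P v → P′ v) →
          ∀ {u v} → Walk E P u v → Walk E P′ u v
  widen = walk-map id

  infixr 5 _▷_
  _▷_ : ∀ {E : V → V → Set} {P u v w} → Walk E P u v → Walk E P v w → Walk E P u w
  stop _   ▷ q = q
  go p e r ▷ q = go p e (r ▷ q)

  walk-head : ∀ {E : V → V → Set} {P u v} → Walk E P u v → P u
  walk-head (stop p)   = p
  walk-head (go p _ _) = p

  walk-last : ∀ {E : V → V → Set} {P u v} → Walk E P u v → P v
  walk-last (stop p)   = p
  walk-last (go _ _ w) = walk-last w

  walk-snoc : ∀ {E : V → V → Set} {P u v w} → Walk E P u v → E v w → P w → Walk E P u w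
  walk-snoc r e p = r ▷ go (walk-last r) e (stop p)

  walk-rev : ∀ {E : V → V → Set} {P} → (∀ {u v} → E u v → E v u) →
             ∀ {u v} → Walk E P u v → Walk E P v u
  walk-rev s (stop p)   = stop p
  walk-rev s (go p e w) = walk-snoc (walk-rev s w) (s e) p

  walk-closed : ∀ {E : V → V → Set} {P R : V → Set} → (∀ {x y} → R x → E x y → P y → R y) →
                ∀ {u v} → R u → Walk E P u v → R v
  walk-closed c r (stop _)   = r
  walk-closed c r (go _ e w) = walk-closed c (c r e (walk-head w)) w

  verts : ∀ {E : V → V → Set} {P u v} → Walk E P u v → List V
  verts (stop {u} _)   = u ∷ []
  verts (go {u} _ _ w) = u ∷ verts w

  verts-P : ∀ {E : V → V → Set} {P u v} (w : Walk E P u v) {z} → z ∈ verts w → P z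
  verts-P (stop p)   (here refl) = p
  verts-P (go p _ _) (here refl) = p
  verts-P (go _ _ w) (there z∈)  = verts-P w z∈

module _ {n : ℕ} where

  private V = Fin n

  suffix : ∀ {E : V → V → Set} {P x u v} (w : Walk E P u v) → Unique (verts w) → x ∈ verts w →
           Σ (Walk E P x v) (Unique ∘ verts)
  suffix w@(stop _)   q       (here refl) = w , q
  suffix w@(go _ _ _) q       (here refl) = w , q
  suffix (go _ _ w)   (_ ∷ q) (there x∈)  = suffix w q x∈

  simple : ∀ {E : V → V → Set} {P u v} → Walk E P u v → Σ (Walk E P u v) (Unique ∘ verts)
  simple (stop p) = stop p , [] ∷ []
  simple (go {u} p e w) with simple w
  ... | w′ , q with u ∈? verts w′
  ... | yes u∈ = suffix w′ q u∈
  ... | no u∉  = go p e w′ , All.tabulate (λ z∈ u≡z → u∉ (subst (_∈ verts w′) (sym u≡z) z∈)) ∷ q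

  -- The part of a walk up to its first vertex in `X`. By `access`, every kept vertex is reached
  -- with at most that vertex itself in `X`: this makes the kept part connected and, for Menger's
  -- theorem, gives walks that avoid a separator.
  record Trim (E : V → V → Set) (P : V → Set) (X : List V) (a : V) : Set where
    field
      {end}  : V
      list   : List V
      end∈X  : end ∈ X
      end∈   : end ∈ list
      allP   : ∀ {z} → z ∈ list → P z
      only   : ∀ {z} → z ∈ list → z ∈ X → z ≡ end
      access : ∀ {z} → z ∈ list → Walk E (λ y → y ∈ list × (y ≡ z ⊎ y ∉ X)) a z
    walk : Walk E (_∈ list) a end
    walk = widen proj₁ (access end∈)

  trim-here : ∀ {E : V → V → Set} {P X u} → P u → u ∈ X → Trim E P X u
  trim-here p u∈X = record
    { list = _ ∷ []; end∈X = u∈X; end∈ = here refl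
    ; allP = λ { (here refl) → p }; only = λ { (here refl) _ → refl }
    ; access = λ { (here refl) → stop (here refl , inj₁ refl) } }

  trim : ∀ {E : V → V → Set} {P} X {a b} → Walk E P a b → b ∈ X → Trim E P X a
  trim X (stop p) b∈X = trim-here p b∈X
  trim X (go {u} p e w) b∈X with u ∈? X
  ... | yes u∈X = trim-here p u∈X
  ... | no u∉X = record
    { list = u ∷ list; end∈X = end∈X; end∈ = there end∈
    ; allP = λ { (here refl) → p ; (there z∈) → allP z∈ }
    ; only = λ { (here refl) z∈X → contradiction z∈X u∉X ; (there z∈) z∈X → only z∈ z∈X }
    ; access = λ { (here refl) → stop (here refl , inj₁ refl)
                 ; (there z∈) → go (here refl , inj₂ u∉X) e
                     (widen (λ (y∈ , q) → there y∈ , q) (access z∈)) } }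
    where open Trim (trim X w b∈X)

  module _ (E : V → V → Set) (E? : ∀ u v → Dec (E u v)) where

    record Closure (P : V → Set) (A : List V) : Set where
      field
        reached : List V
        sound   : ∀ {v} → v ∈ reached → ∃[ a ] a ∈ A × Walk E P a v
        compl   : ∀ {a v} → a ∈ A → Walk E P a v → v ∈ reached

    closure : ∀ {P : V → Set} → (∀ v → Dec (P v)) → ∀ A → Closure P A
    -- Every round of `grow` adds a new vertex and no set has more than `n`, so the fuel `suc n`
    -- cannot run out; the invariant `n < card R + f` records this.
    closure {P} P? A = grow (suc n) (filter P? A) (m≤n+m (suc n) _)
                         (λ v∈ → let v∈A , p = ∈-filter⁻ P? v∈ in _ , v∈A , stop p)
                         (λ a∈ p → ∈-filter⁺ P? a∈ p)
      where
      grow : ∀ f R → n < card R + f → (∀ {v} → v ∈ R → ∃[ a ] a ∈ A × Walk E P a v) →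
             (∀ {a} → a ∈ A → P a → a ∈ R) → Closure P A
      grow zero R lt snd ini =
        contradiction (card≤n R) (<⇒≱ (subst (n <_) (+-identityʳ _) lt))
      grow (suc f) R lt snd ini
        with any? (λ w → P? w ×-dec (¬? (w ∈? R) ×-dec Any.any? (λ r → E? r w) R))
      ... | no none = record
        { reached = R ; sound = snd
        ; compl = λ a∈ w → walk-closed
            (λ {x} {y} x∈ e p → decidable-stable (y ∈? R)
               λ y∉ → none (y , p , y∉ , Any.map (λ { refl → e }) x∈))
            (ini a∈ (walk-head w)) w }
      ... | yes (w , p , w∉ , ex) = grow f (w ∷ R)
        (≤-trans lt (≤-trans (≤-reflexive (+-suc _ f)) (+-monoˡ-≤ f (card-< there w∉ (here refl)))))
        (λ { (here refl) → let r , r∈ , e = find ex ; a , a∈ , q = snd r∈ in a , a∈ , walk-snoc q e p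
           ; (there v∈) → snd v∈ })
        (λ a∈ q → there (ini a∈ q))

-- Menger's theorem, after Göring: induction on the number of edges

lookup-injective : ∀ {A : Set} {xs : List A} → Unique xs → ∀ {i j} → lookup xs i ≡ lookup xs j → i ≡ j
lookup-injective (_ ∷ _) {zero}  {zero}  _  = refl
lookup-injective (h ∷ _) {zero}  {suc j} eq = contradiction eq (All.lookup h (∈-lookup j))
lookup-injective (h ∷ _) {suc i} {zero}  eq = contradiction (sym eq) (All.lookup h (∈-lookup i))
lookup-injective (_ ∷ u) {suc i} {suc j} eq = cong suc (lookup-injective u eq)

-- A missed value could be punched out of the codomain, leaving an injection from `Fin k` into
-- `Fin m`.
injective⇒surjective : ∀ {k m} {f : Fin k → Fin (suc m)} → Injective _≡_ _≡_ f → m < k →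
                       ∀ s → ∃[ j ] f j ≡ s
injective⇒surjective {f = f} inj m<k s with any? (λ j → f j ≟ s)
... | yes found = found
... | no none   = contradiction m<k (≤⇒≯ (injective⇒≤ {f = λ j → punchOut (missed j)}
                    (λ {i} {j} eq → inj (punchOut-injective (missed i) (missed j) eq))))
  where missed : ∀ j → s ≢ f j
        missed j s≡ = none (j , sym s≡)

module _ {n : ℕ} where

  private V = Fin n

  -- An undirected graph as a list of pairs, so that deleting an edge is dropping the head of the
  -- list.
  EdgeOf : List (V × V) → V → V → Set
  EdgeOf L u v = (u , v) ∈ L ⊎ (v , u) ∈ L

  edgeOf? : ∀ L u v → Dec (EdgeOf L u v)
  edgeOf? L u v = Any.any? (≡-dec _≟_ _≟_ (u , v)) L ⊎-dec Any.any? (≡-dec _≟_ _≟_ (v , u)) L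

  edgeOf-swap : ∀ {x y L u v} → EdgeOf ((x , y) ∷ L) u v → EdgeOf ((y , x) ∷ L) u v
  edgeOf-swap (inj₁ (here refl)) = inj₂ (here refl)
  edgeOf-swap (inj₁ (there e))   = inj₁ (there e)
  edgeOf-swap (inj₂ (here refl)) = inj₁ (here refl)
  edgeOf-swap (inj₂ (there e))   = inj₂ (there e)

  edgeOf-there : ∀ {e L u v} → EdgeOf L u v → EdgeOf (e ∷ L) u v
  edgeOf-there (inj₁ e) = inj₁ (there e)
  edgeOf-there (inj₂ e) = inj₂ (there e)

  -- A walk may be a single vertex, so `Y` has to contain the intersection of `A` and `B`.
  Separates : List (V × V) → (A B Y : List V) → Set
  Separates L A B Y = ∀ {a b} → a ∈ A → b ∈ B → ¬ Walk (EdgeOf L) (_∉ Y) a b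

  separates-sym : ∀ {L A B Y} → Separates L A B Y → Separates L B A Y
  separates-sym sep b∈ a∈ w = sep a∈ b∈ (walk-rev swap w)

  Reachable : List (V × V) → (A P : List V) → V → Set
  Reachable L A P v = ∃[ a ] a ∈ A × Walk (EdgeOf L) (_∉ P) a v

  reachable? : ∀ L A P v → Dec (Reachable L A P v)
  reachable? L A P v = map′ sound (λ (_ , a∈ , w) → compl a∈ w) (v ∈? reached)
    where open Closure (closure (EdgeOf L) (edgeOf? L) (λ u → ¬? (u ∈? P)) A)

  record Linkage (L : List (V × V)) (A B : List V) (k : ℕ) : Set where
    field
      path     : Fin k → List V
      src tgt  : Fin k → V
      src∈     : ∀ i → src i ∈ A
      tgt∈     : ∀ i → tgt i ∈ B
      walk     : ∀ i → Walk (EdgeOf L) (_∈ path i) (src i) (tgt i)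
      disjoint : ∀ {i j v} → v ∈ path i → v ∈ path j → i ≡ j

  -- The set reachable from `A` off `P` stays closed when the new edge does not lead out of it.
  separates-add-edge : ∀ {x y L A B P} → Separates L A B P →
    (Reachable L A P x → Reachable L A P y) → (Reachable L A P y → Reachable L A P x) →
    Separates ((x , y) ∷ L) A B P
  separates-add-edge {x} {y} {L} {A} {B} {P} sep xy yx a∈ b∈ w =
    let a , a∈ , w′ = walk-closed {R = Reachable L A P} closed (_ , a∈ , stop (walk-head w)) w
    in sep a∈ b∈ w′
    where
    closed : ∀ {u v} → Reachable L A P u → EdgeOf ((x , y) ∷ L) u v → v ∉ P → Reachable L A P v
    closed r (inj₁ (here refl)) _ = xy r
    closed r (inj₂ (here refl)) _ = yx r
    closed (a , a∈ , r) (inj₁ (there e)) v∉ = a , a∈ , walk-snoc r (inj₁ e) v∉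
    closed (a , a∈ , r) (inj₂ (there e)) v∉ = a , a∈ , walk-snoc r (inj₂ e) v∉

  -- A walk that leaves A and avoids Y stays clear of x ∷ P in the smaller graph: it cannot
  -- enter x through the new edge, since y lies beyond P.
  separates-lift : ∀ {x y L A B P Y} → Separates L A B P → ¬ Reachable L A P y →
                   Separates L A (x ∷ P) Y → Separates ((x , y) ∷ L) A B Y
  separates-lift {x} {y} {L} {A} {B} {P} {Y} sepP y∉ sepY {a} a∈ b∈ w =
    sepP a∈ b∈ (widen (λ (_ , q) → q ∘ there) (walk-closed {R = R} closed
      (stop (walk-head w , λ a∈X → sepY a∈ a∈X (stop (walk-head w)))) w))
    where
    R : V → Set
    R = Walk (EdgeOf L) (λ z → z ∉ Y × z ∉ x ∷ P) a
    along : ∀ {u v} → R u → EdgeOf L u v → v ∉ Y → R v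
    along r e v∉ = walk-snoc r e (v∉ , λ v∈X → sepY a∈ v∈X (walk-snoc (widen proj₁ r) e v∉))
    closed : ∀ {u v} → R u → EdgeOf ((x , y) ∷ L) u v → v ∉ Y → R v
    closed r (inj₁ (here refl)) _ = contradiction (here refl) (proj₂ (walk-last r))
    closed r (inj₂ (here refl)) _ = contradiction (a , a∈ , widen (λ (_ , q) → q ∘ there) r) y∉
    closed r (inj₁ (there e)) = along r (inj₁ e)
    closed r (inj₂ (there e)) = along r (inj₂ e)

  -- A common numbering of `x ∷ P` and `y ∷ P`: members of `P` by position, anything else by zero.
  -- Two ends in the same slot coincide or are `x` and `y`, which the new edge joins.
  slot : (P : List V) → V → Fin (suc (length P))
  slot P v with v ∈? P
  ... | yes v∈ = suc (Any.index v∈)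
  ... | no _   = zero

  slot-match : ∀ {x y} P {v w} → v ∈ x ∷ P → w ∈ y ∷ P → slot P v ≡ slot P w →
               v ≡ w ⊎ (v ≡ x × w ≡ y × w ∉ P)
  slot-match P {v} {w} v∈ w∈ eq with v ∈? P | w ∈? P
  ... | yes p | yes q = inj₁ (trans (lookup-index p)
                          (trans (cong (lookup P) (Fin.suc-injective eq)) (sym (lookup-index q))))
  ... | no p  | no q  = inj₂ (head p v∈ , head q w∈ , q)
    where open Any using (head)

  slot-injective : ∀ {x} P {v w} → v ∈ x ∷ P → w ∈ x ∷ P → slot P v ≡ slot P w → v ≡ w
  slot-injective P v∈ w∈ eq with slot-match P v∈ w∈ eq
  ... | inj₁ v≡w               = v≡w
  ... | inj₂ (v≡x , w≡x , _) = trans v≡x (sym w≡x)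

  module _ {x y : V} {L A B P k} (P<k : length P < k) (sep : Separates L A B P)
           (LA : Linkage L A (x ∷ P) k) (LB : Linkage L B (y ∷ P) k) where

    private
      module ΛA = Linkage LA
      module ΛB = Linkage LB

      trimA : ∀ i → Trim (EdgeOf L) (_∈ ΛA.path i) (x ∷ P) (ΛA.src i)
      trimA i = trim (x ∷ P) (ΛA.walk i) (ΛA.tgt∈ i)

      trimB : ∀ i → Trim (EdgeOf L) (_∈ ΛB.path i) (y ∷ P) (ΛB.src i)
      trimB i = trim (y ∷ P) (ΛB.walk i) (ΛB.tgt∈ i)

      module TA i = Trim (trimA i)
      module TB i = Trim (trimB i)

      endA-injective : ∀ {i j} → TA.end i ≡ TA.end j → i ≡ j
      endA-injective {i} {j} eq =
        ΛA.disjoint (TA.allP i (TA.end∈ i)) (subst (_∈ ΛA.path j) (sym eq) (TA.allP j (TA.end∈ j)))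

      endB-injective : ∀ {i j} → TB.end i ≡ TB.end j → i ≡ j
      endB-injective {i} {j} eq =
        ΛB.disjoint (TB.allP i (TB.end∈ i)) (subst (_∈ ΛB.path j) (sym eq) (TB.allP j (TB.end∈ j)))

      -- The `k` ends on the side of `B` occupy distinct slots, and there are only `suc (length P)`,
      -- at most `k`, of these: every slot is hit.
      matched : ∀ i → ∃[ j ] slot P (TB.end j) ≡ slot P (TA.end i)
      matched i = injective⇒surjective
        (λ {i} {j} eq → endB-injective (slot-injective P (TB.end∈X i) (TB.end∈X j) eq)) P<k _

      π : Fin k → Fin k
      π i = proj₁ (matched i)

      π-slot : ∀ i → slot P (TA.end i) ≡ slot P (TB.end (π i))
      π-slot i = sym (proj₂ (matched i))

      ends : ∀ i → TA.end i ≡ TB.end (π i) ⊎ (TA.end i ≡ x × TB.end (π i) ≡ y × TB.end (π i) ∉ P)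
      ends i = slot-match P (TA.end∈X i) (TB.end∈X (π i)) (π-slot i)

      -- A meeting point off `P` would give a walk from `A` to `B` avoiding `P`; on `P` both trimmed
      -- paths end.
      cross : ∀ {i j v} → v ∈ TA.list i → v ∈ TB.list j → v ≡ TA.end i × v ≡ TB.end j × v ∈ P
      cross {i} {j} {v} v∈A v∈B with v ∈? P
      ... | yes v∈P = TA.only i v∈A (there v∈P) , TB.only j v∈B (there v∈P) , v∈P
      ... | no v∉P  = contradiction
        (widen avoid (TA.access i v∈A) ▷ walk-rev swap (widen avoid (TB.access j v∈B)))
        (sep (ΛA.src∈ i) (ΛB.src∈ j))
        where
        avoid : ∀ {z u} {R : Set} → R × (z ≡ v ⊎ z ∉ u ∷ P) → z ∉ P
        avoid (_ , inj₁ refl) = v∉P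
        avoid (_ , inj₂ z∉)   = z∉ ∘ there

      cross-index : ∀ {i j v} → v ∈ TA.list i → v ∈ TB.list (π j) → i ≡ j
      cross-index {i} {j} v∈A v∈B with cross v∈A v∈B | ends j
      ... | v≡ , v≡′ , _   | inj₁ eq           = endA-injective (trans (sym v≡) (trans v≡′ (sym eq)))
      ... | _ , refl , v∈P | inj₂ (_ , _ , ∉P) = contradiction v∈P ∉P

    linkage-glue : Linkage ((x , y) ∷ L) A B k
    linkage-glue = record
      { path = path; src = ΛA.src; tgt = ΛB.src ∘ π; src∈ = ΛA.src∈; tgt∈ = ΛB.src∈ ∘ π
      ; walk = walk; disjoint = λ {i} {j} v∈ v∈′ →
          disj (∈-++⁻ (TA.list i) v∈) (∈-++⁻ (TA.list j) v∈′) }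
      where
      path : Fin k → List V
      path i = TA.list i ++ TB.list (π i)
      walk : ∀ i → Walk (EdgeOf ((x , y) ∷ L)) (_∈ path i) (ΛA.src i) (ΛB.src (π i))
      walk i with walk-map edgeOf-there (∈-++⁺ˡ {ys = TB.list (π i)}) (TA.walk i)
                | walk-rev swap (walk-map edgeOf-there (∈-++⁺ʳ (TA.list i)) (TB.walk (π i)))
                | ends i
      ... | wA | wB | inj₁ eq = subst (Walk _ _ _) eq wA ▷ wB
      ... | wA | wB | inj₂ (eqA , eqB , _) = wA ▷ go (walk-last wA) (inj₁ (here (cong₂ _,_ eqA eqB))) wB
      disj : ∀ {i j v} → v ∈ TA.list i ⊎ v ∈ TB.list (π i) → v ∈ TA.list j ⊎ v ∈ TB.list (π j) → i ≡ j
      disj {i} {j} (inj₁ p) (inj₁ q) = ΛA.disjoint (TA.allP i p) (TA.allP j q)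
      disj         (inj₁ p) (inj₂ q) = cross-index p q
      disj         (inj₂ p) (inj₁ q) = sym (cross-index q p)
      disj {i} {j} (inj₂ p) (inj₂ q) = endA-injective (slot-injective P (TA.end∈X i) (TA.end∈X j)
        (trans (π-slot i) (trans
          (cong (slot P ∘ TB.end) (ΛB.disjoint (TB.allP (π i) p) (TB.allP (π j) q)))
          (sym (π-slot j)))))

  linkage-there : ∀ {e L A B k} → Linkage L A B k → Linkage (e ∷ L) A B k
  linkage-there Λ = record { Linkage Λ; walk = λ i → walk-map edgeOf-there id (Linkage.walk Λ i) }

  MengerFor : List (V × V) → Set
  MengerFor L = ∀ A B k → (∃[ Y ] length Y < k × Separates L A B Y) ⊎ Linkage L A B k

  -- As the new edge leaves the side of `A`, both `x ∷ P` and `y ∷ P` separate in the larger graph.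
  -- A small separator of `A` from `x ∷ P`, or of `B` from `y ∷ P`, in the smaller graph also
  -- separates `A` from `B`; otherwise the linkages on the two sides are glued at `P` and along the
  -- edge.
  menger-cross : ∀ {x y L A B P k} → MengerFor L → length P < k → Separates L A B P →
    Reachable L A P x → ¬ Reachable L A P y →
    (∃[ Y ] length Y < k × Separates ((x , y) ∷ L) A B Y) ⊎ Linkage ((x , y) ∷ L) A B k
  menger-cross {x} {y} {L} {A} {B} {P} {k} menger P<k sep (a , a∈ , rx) y∉
    with menger A (x ∷ P) k | menger B (y ∷ P) k
  ... | inj₁ (Y , Y<k , sepY) | _ = inj₁ (Y , Y<k , separates-lift sep y∉ sepY)
  ... | inj₂ _ | inj₁ (Y , Y<k , sepY) = inj₁ (Y , Y<k , λ a∈ b∈ w → separates-sym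
        (separates-lift (separates-sym sep) x∉ sepY) a∈ b∈ (walk-map edgeOf-swap id w))
    where
    x∉ : ¬ Reachable L B P x
    x∉ (b , b∈ , r) = sep a∈ b∈ (rx ▷ walk-rev swap r)
  ... | inj₂ ΛA | inj₂ ΛB = inj₂ (linkage-glue P<k sep ΛA ΛB)

  menger : ∀ L → MengerFor L
  -- Without edges walks are single vertices: the intersection `X` of `A` and `B` is the separator
  -- if it is small and supplies the paths otherwise.
  menger [] A B k with length X <? k
    where X = filter (_∈? B) (filter (_∈? A) (allFin n))
  ... | yes X<k = inj₁ (_ , X<k , λ { a∈ b∈ (stop a∉) →
          a∉ (∈-filter⁺ (_∈? B) (∈-filter⁺ (_∈? A) (∈-allFin _) a∈) b∈) ; _ _ (go _ (inj₁ ()) _)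
          ; _ _ (go _ (inj₂ ()) _) })
  ... | no X≮k = inj₂ record
    { path = λ i → at i ∷ []; src = at; tgt = at
    ; src∈ = λ i → proj₂ (∈-filter⁻ (_∈? A) {xs = allFin n} (proj₁ (at∈ i))); tgt∈ = λ i → proj₂ (at∈ i)
    ; walk = λ _ → stop (here refl)
    ; disjoint = λ { (here refl) (here eq) → inject≤-injective _ _ _ _ (lookup-injective unique eq) } }
    where
    X = filter (_∈? B) (filter (_∈? A) (allFin n))
    unique : Unique X
    unique = Unique.filter⁺ (_∈? B) (Unique.filter⁺ (_∈? A) (Unique.allFin⁺ n))
    at : Fin k → V
    at i = lookup X (inject≤ i (≮⇒≥ X≮k))
    at∈ : ∀ i → at i ∈ filter (_∈? A) (allFin n) × at i ∈ B
    at∈ i = ∈-filter⁻ (_∈? B) (∈-lookup {xs = X} (inject≤ i (≮⇒≥ X≮k)))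
  menger ((x , y) ∷ L) A B k with menger L A B k
  ... | inj₂ Λ = inj₂ (linkage-there Λ)
  ... | inj₁ (P , P<k , sep) with reachable? L A P x | reachable? L A P y
  ... | yes rx | yes ry = inj₁ (P , P<k , separates-add-edge sep (λ _ → ry) (λ _ → rx))
  ... | no ¬rx | no ¬ry =
        inj₁ (P , P<k , separates-add-edge sep (λ r → contradiction r ¬rx) (λ r → contradiction r ¬ry))
  ... | yes rx | no ¬ry = menger-cross (menger L) P<k sep rx ¬ry
  ... | no ¬rx | yes ry with menger-cross (menger L) P<k sep ry ¬rx
  ... | inj₁ (Y , Y<k , sepY) = inj₁ (Y , Y<k , λ a∈ b∈ w → sepY a∈ b∈ (walk-map edgeOf-swap id w))
  ... | inj₂ Λ = inj₂ record { Linkage Λ; walk = λ i → walk-map edgeOf-swap id (Linkage.walk Λ i) }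

-- Chains of branches rooted at S

-- Reversing the first list onto the second puts their heads side by side; two chains will be joined
-- at their heads in this way.
linked-ʳ++ : ∀ {A : Set} {R : A → A → Set} → (∀ {x y} → R x y → R y x) → ∀ {x xs y ys} →
             Linked R (x ∷ xs) → Linked R (y ∷ ys) → R x y → Linked R ((x ∷ xs) ʳ++ (y ∷ ys))
linked-ʳ++ s [-]      m xy = xy ∷ m
linked-ʳ++ s (r ∷ l)  m xy = linked-ʳ++ s l (xy ∷ m) (s r)

allPairs-ʳ++ : ∀ {A : Set} {R : A → A → Set} → (∀ {x y} → R x y → R y x) → ∀ xs {ys} →
               AllPairs R xs → AllPairs R ys → (∀ {x y} → x ∈ xs → y ∈ ys → R x y) →
               AllPairs R (xs ʳ++ ys)
allPairs-ʳ++ s []       _        q _ = q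
allPairs-ʳ++ s (x ∷ xs) (h ∷ p) q c = allPairs-ʳ++ s xs p (All.tabulate (c (here refl)) ∷ q)
  λ { x∈ (here refl) → s (All.lookup h x∈) ; x∈ (there y∈) → c (there x∈) y∈ }

all-ʳ++ : ∀ {A : Set} {P : A → Set} xs {ys} → All P xs → All P ys → All P (xs ʳ++ ys)
all-ʳ++ []       _        q = q
all-ʳ++ (x ∷ xs) (p ∷ ps) q = all-ʳ++ xs ps (p ∷ q)

covering⇒≤ : ∀ {k} (is : List (Fin k)) → (∀ i → i ∈ is) → k ≤ length is
covering⇒≤ is mem = injective⇒≤ {f = Any.index ∘ mem} λ {i} {j} eq →
  trans (lookup-index (mem i)) (trans (cong (lookup is) eq) (sym (lookup-index (mem j))))

module Chains {n : ℕ} (E : Fin n → Fin n → Set) (E-sym : ∀ {u v} → E u v → E v u) where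

  private V = Fin n

  Conn : List V → Set
  Conn xs = ∀ {u v} → u ∈ xs → v ∈ xs → Walk E (_∈ xs) u v

  Adj : List V → List V → Set
  Adj xs ys = ∃[ u ] ∃[ v ] u ∈ xs × v ∈ ys × E u v

  Disj : List V → List V → Set
  Disj xs ys = ∀ {v} → v ∈ xs → v ∉ ys

  adj-sym : ∀ {xs ys} → Adj xs ys → Adj ys xs
  adj-sym (u , v , u∈ , v∈ , e) = v , u , v∈ , u∈ , E-sym e

  disj-sym : ∀ {xs ys} → Disj xs ys → Disj ys xs
  disj-sym d v∈ v∈′ = d v∈′ v∈

  conn-from : ∀ {c xs} → (∀ {v} → v ∈ xs → Walk E (_∈ xs) c v) → Conn xs
  conn-from f u∈ v∈ = walk-rev E-sym (f u∈) ▷ f v∈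

  conn-++ : ∀ {xs ys z} → Conn xs → Conn ys → z ∈ xs → z ∈ ys → Conn (xs ++ ys)
  conn-++ {xs} {ys} cx cy zx zy = conn-from λ v∈ → [ (λ v∈x → widen ∈-++⁺ˡ (cx zx v∈x))
    , (λ v∈y → widen (∈-++⁺ʳ xs) (cy zy v∈y)) ]′ (∈-++⁻ xs v∈)

  conn-adj : ∀ {xs ys} → Conn xs → Conn ys → Adj xs ys → Conn (xs ++ ys)
  conn-adj {xs} {ys} cx cy (u , w , u∈ , w∈ , e) = conn-from λ v∈ → [ (λ v∈x → widen ∈-++⁺ˡ (cx u∈ v∈x))
    , (λ v∈y → go (∈-++⁺ˡ u∈) e (widen (∈-++⁺ʳ xs) (cy w∈ v∈y))) ]′ (∈-++⁻ xs v∈)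

  trim-conn : ∀ {P X a} (t : Trim E P X a) → Conn (Trim.list t)
  trim-conn t = conn-from λ v∈ → widen proj₁ (Trim.access t v∈)

  record Branch (S Z b : List V) : Set where
    constructor branch
    field
      conn   : Conn b
      root   : V
      root∈S : root ∈ S
      root∈  : root ∈ b
      within : ∀ {v} → v ∈ b → v ∈ Z
  open Branch

  record Chain (S Z : List V) (bs : List (List V)) : Set where
    constructor chain
    field
      branches : All (Branch S Z) bs
      disjoint : AllPairs Disj bs
      linked   : Linked Adj bs

  open Chain

  chain-concat : ∀ {S Z b bs} → Chain S Z (b ∷ bs) → Conn (concat (b ∷ bs))
  chain-concat {b = b} {[]} (chain (β ∷ []) _ _) = conn-from λ v∈ →
    [ (λ v∈b → widen ∈-++⁺ˡ (conn β (root∈ β) v∈b)) , (λ ()) ]′ (∈-++⁻ b v∈)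
  chain-concat {bs = _ ∷ _} (chain (β ∷ βs) (_ ∷ d) ((u , v , u∈ , v∈ , e) ∷ l)) =
    conn-adj (conn β) (chain-concat (chain βs d l)) (u , v , u∈ , ∈-++⁺ˡ v∈ , e)

  concat-within : ∀ {S Z bs} → All (Branch S Z) bs → ∀ {v} → v ∈ concat bs → v ∈ Z
  concat-within {bs = bs} βs v∈ = let b , v∈b , b∈ = ∈-concat⁻′ bs v∈ in within (All.lookup βs b∈) v∈b

  chain-widen : ∀ {S Z Z′ bs} → (∀ {v} → v ∈ Z → v ∈ Z′) → Chain S Z bs → Chain S Z′ bs
  chain-widen f (chain βs d l) =
    chain (All.map (λ (branch c r r∈S r∈ w) → branch c r r∈S r∈ (f ∘ w)) βs) d l

  -- Disjoint legs cut a path into a chain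

  record Legs (S Z Q : List V) (k : ℕ) : Set where
    field
      leg      : Fin k → List V
      foot     : Fin k → V
      foot∈Q   : ∀ i → foot i ∈ Q
      foot∈    : ∀ i → foot i ∈ leg i
      branches : ∀ i → Branch S Z (leg i)
      only     : ∀ {i v} → v ∈ leg i → v ∈ Q → v ≡ foot i
      disjoint : ∀ {i j v} → v ∈ leg i → v ∈ leg j → i ≡ j

  module _ {S Z Q : List V} {k : ℕ} (Q⊆Z : ∀ {v} → v ∈ Q → v ∈ Z) (Λ : Legs S Z Q k) where

    private module Λ = Legs Λ

    -- The first tooth contains the first vertex of the remaining path and is therefore adjacent to
    -- the vertex preceding that.
    HeadsMeet : List V → List (List V) → Set
    HeadsMeet _       []      = ⊤
    HeadsMeet []      (_ ∷ _) = ⊥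
    HeadsMeet (q ∷ _) (b ∷ _) = q ∈ b

    -- A tooth is a leg together with the stretch of the path before its foot, back to the previous
    -- foot; vertices behind the last foot are dropped. `indices` names the leg in each tooth, for
    -- counting.
    record Comb (qs : List V) : Set where
      field
        teeth   : List (List V)
        indices : List (Fin k)
        same    : length indices ≡ length teeth
        isChain : Chain S Z teeth
        covers  : ∀ {i} → Λ.foot i ∈ qs → i ∈ indices
        heads   : HeadsMeet qs teeth
        inside  : ∀ {b v} → b ∈ teeth → v ∈ b → v ∈ qs ⊎ ∃[ i ] Λ.foot i ∈ qs × v ∈ Λ.leg i

    inside-there : ∀ {q qs} {v : V} → v ∈ qs ⊎ (∃[ i ] Λ.foot i ∈ qs × v ∈ Λ.leg i) →
                   v ∈ q ∷ qs ⊎ (∃[ i ] Λ.foot i ∈ q ∷ qs × v ∈ Λ.leg i)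
    inside-there (inj₁ v∈)             = inj₁ (there v∈)
    inside-there (inj₂ (i , f∈ , v∈)) = inj₂ (i , there f∈ , v∈)

    adj-heads : ∀ {q qs b bs} → Linked E (q ∷ qs) → HeadsMeet qs (b ∷ bs) → Adj (q ∷ []) b
    adj-heads {q} {q′ ∷ _} (e ∷ _) q′∈b = q , q′ , here refl , q′∈b , e

    adj-⊆ : ∀ {xs ys zs} → (∀ {v} → v ∈ xs → v ∈ ys) → Adj xs zs → Adj ys zs
    adj-⊆ f (u , v , u∈ , v∈ , e) = u , v , f u∈ , v∈ , e

    comb : ∀ qs → (∀ {v} → v ∈ qs → v ∈ Q) → Unique qs → Linked E qs → Comb qs
    comb [] _ _ _ = record
      { teeth = []; indices = []; same = refl; isChain = chain [] [] []; covers = λ ()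
      ; heads = tt; inside = λ () }
    comb (q ∷ qs) ⊆Q (q# ∷ uq) lk with comb qs (⊆Q ∘ there) uq (Linked.tail lk)
                                     | any? (λ i → Λ.foot i ≟ q)
    ... | record { teeth = bs; indices = is; same = same; isChain = chain βs ds ls
                 ; covers = cov; heads = hd; inside = ins } | yes (i , refl) = record
      { teeth = Λ.leg i ∷ bs; indices = i ∷ is; same = cong suc same
      ; isChain = chain (Λ.branches i ∷ βs) (All.tabulate sepd ∷ ds) (link ls hd)
      ; covers = λ { (here eq) → here (Λ.disjoint (subst (_∈ Λ.leg _) eq (Λ.foot∈ _)) (Λ.foot∈ i))
                   ; (there f∈) → there (cov f∈) }
      ; heads = Λ.foot∈ i
      ; inside = λ { (here refl) v∈ → inj₂ (i , here refl , v∈)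
                   ; (there b∈) v∈ → inside-there (ins b∈ v∈) } }
      where
      q∉ : Λ.foot i ∉ qs
      q∉ q∈ = All.lookup q# q∈ refl
      sepd : ∀ {b} → b ∈ bs → Disj (Λ.leg i) b
      sepd b∈ v∈l v∈b with ins b∈ v∈b
      ... | inj₁ v∈qs = q∉ (subst (_∈ qs) (Λ.only v∈l (⊆Q (there v∈qs))) v∈qs)
      ... | inj₂ (j , f∈ , v∈) = q∉ (subst (λ i → Λ.foot i ∈ qs) (Λ.disjoint v∈ v∈l) f∈)
      link : ∀ {bs} → Linked Adj bs → HeadsMeet qs bs → Linked Adj (Λ.leg i ∷ bs)
      link {[]}    _ _ = [-]
      link {b ∷ _} l h = adj-⊆ (λ { (here refl) → Λ.foot∈ i }) (adj-heads lk h) ∷ l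
    ... | record { teeth = []; indices = is; same = same; covers = cov } | no q≢ = record
      { teeth = []; indices = is; same = same; isChain = chain [] [] []
      ; covers = λ { (here eq) → contradiction (_ , eq) q≢ ; (there f∈) → cov f∈ }
      ; heads = tt; inside = λ () }
    ... | record { teeth = b ∷ bs; indices = is; same = same
                 ; isChain = chain (branch c r r∈S r∈ w ∷ βs) (d ∷ ds) ls
                 ; covers = cov; heads = hd; inside = ins } | no q≢ = record
      { teeth = (q ∷ b) ∷ bs; indices = is; same = same
      ; isChain = chain
          (branch (conn-adj single c (adj-heads lk hd)) r r∈S (there r∈)
            (λ { (here refl) → Q⊆Z (⊆Q (here refl)) ; (there v∈) → w v∈ }) ∷ βs)
          (All.tabulate (λ { b∈ (here refl) → q∉ b∈ ; b∈ (there v∈) → All.lookup d b∈ v∈ }) ∷ ds)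
          (link ls)
      ; covers = λ { (here eq) → contradiction (_ , eq) q≢ ; (there f∈) → cov f∈ }
      ; heads = here refl
      ; inside = λ { (here refl) (here refl) → inj₁ (here refl)
                   ; (here refl) (there v∈) → inside-there (ins (here refl) v∈)
                   ; (there b∈) v∈ → inside-there (ins (there b∈) v∈) } }
      where
      single : Conn (q ∷ [])
      single (here refl) (here refl) = stop (here refl)
      q∉ : ∀ {b′} → b′ ∈ bs → q ∉ b′
      q∉ b∈ q∈ with ins (there b∈) q∈
      ... | inj₁ q∈qs = All.lookup q# q∈qs refl
      ... | inj₂ (j , f∈ , q∈l) = q≢ (j , sym (Λ.only q∈l (⊆Q (here refl))))
      link : Linked Adj (b ∷ bs) → Linked Adj ((q ∷ b) ∷ bs)
      link [-]     = [-]
      link (a ∷ l) = adj-⊆ there a ∷ l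

    legs⇒chain : Unique Q → Linked E Q → ∃[ bs ] Chain S Z bs × k ≤ length bs
    legs⇒chain uq lk = teeth , isChain ,
      ≤-trans (covering⇒≤ indices (λ i → covers (Λ.foot∈Q i))) (≤-reflexive same)
      where open Comb (comb Q id uq lk)

  -- Joining two disjoint chains

  record Half (S Z : List V) (bs : List (List V)) (x : V) : Set where
    constructor half
    field
      {b}     : List V
      {tail}  : List (List V)
      x∈b     : x ∈ b
      isChain : Chain S Z (b ∷ tail)
      -- More than half of the chain, counting the branch of `x`: two such halves together exceed
      -- the shorter of their chains.
      long    : length bs < length (b ∷ tail) + length (b ∷ tail)
      ⊆bs     : ∀ {c} → c ∈ b ∷ tail → c ∈ bs

  -- A zipper: `ls` holds the branches before `b` in reverse order and `rs` those after it, so both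
  -- directions are chains starting at `b`. Once `b` contains `x`, the longer one is kept.
  locate : ∀ {S Z bs x} ls b rs → Chain S Z (b ∷ ls) → Chain S Z (b ∷ rs) →
           (∀ {l r} → l ∈ ls → r ∈ rs → Disj l r) →
           (∀ {c} → c ∈ b ∷ ls → c ∈ bs) → (∀ {c} → c ∈ b ∷ rs → c ∈ bs) →
           length bs ≡ suc (length ls + length rs) → x ∈ concat (b ∷ rs) → Half S Z bs x
  locate ls b rs cl cr sep ⊆l ⊆r eq x∈ with ∈-++⁻ b x∈
  ... | inj₁ x∈b with ≤-total (length ls) (length rs)
  ... | inj₁ l≤r = half x∈b cr (≤-trans (≤-reflexive (cong suc eq))
          (s≤s (≤-trans (s≤s (+-monoˡ-≤ _ l≤r)) (≤-reflexive (sym (+-suc _ _)))))) ⊆r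
  ... | inj₂ r≤l = half x∈b cl (≤-trans (≤-reflexive (cong suc eq))
          (s≤s (≤-trans (s≤s (+-monoʳ-≤ _ r≤l)) (≤-reflexive (sym (+-suc _ _)))))) ⊆l
  locate ls b (r ∷ rs) (chain βl dl ll) (chain (β ∷ βr) (d ∷ dr) (a ∷ lr)) sep ⊆l ⊆r eq x∈ | inj₂ x∈rs =
    locate (b ∷ ls) r rs
      (chain (All.head βr ∷ βl)
             ((disj-sym (All.head d) ∷ All.tabulate (λ l∈ → disj-sym (sep l∈ (here refl)))) ∷ dl)
             (adj-sym a ∷ ll))
      (chain βr dr lr)
      (λ { (here refl) r∈ → All.lookup d (there r∈) ; (there l∈) r∈ → sep l∈ (there r∈) })
      (λ { (here refl) → ⊆r (there (here refl)) ; (there c∈) → ⊆l c∈ })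
      (⊆r ∘ there) (trans eq (cong suc (+-suc _ _))) x∈rs

  half-at : ∀ {S Z bs x} → Chain S Z bs → x ∈ concat bs → Half S Z bs x
  half-at {bs = b ∷ bs} c@(chain (β ∷ _) _ _) x∈ =
    locate [] b bs (chain (β ∷ []) ([] ∷ []) [-]) c (λ ()) (λ { (here refl) → here refl }) id refl x∈

  before : ∀ {P X a b} → Walk E P a b → a ∉ X → b ∈ X →
           ∃[ y ] ∃[ x ] E y x × x ∈ X × Walk E (λ v → P v × v ∉ X) a y
  before (stop _) a∉ b∈ = contradiction b∈ a∉
  before {X = X} (go {a} {w} p e r) a∉ b∈ with w ∈? X
  ... | yes w∈ = a , w , e , w∈ , stop (p , a∉)
  ... | no w∉  = let y , x , e′ , x∈ , q = before r w∉ b∈ in y , x , e′ , x∈ , go (p , a∉) e q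

  -- Linking the longer halves of the two chains at the ends of a connecting walk.
  chain-join : ∀ {S Z bs cs a c m} → Conn Z → Chain S Z bs → Chain S Z cs →
               m ≤ length bs → m ≤ length cs → Disj (concat bs) (concat cs) →
               a ∈ concat bs → c ∈ concat cs → ∃[ ds ] Chain S Z ds × suc m ≤ length ds
  chain-join {S} {Z} {bs} {cs} {a} {c} {m} conZ Bs Cs m≤b m≤c dj a∈ c∈
    -- The walk is cut at `y`, just before it first enters `cs`, and followed back from `y` to the
    -- first vertex in `bs`. The stretch between misses `cs` and meets `bs` only in its end, so the
    -- branch containing that end can absorb it.
    with before (conZ (concat-within (branches Bs) a∈) (concat-within (branches Cs) c∈)) (dj a∈) c∈
  ... | y , x , e , x∈ , w with trim (concat bs) (walk-rev E-sym w) a∈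
  ... | t with half-at Bs (Trim.end∈X t) | half-at Cs x∈
  ... | half {b} {hs} z∈b (chain (branch cn r r∈S r∈ wi ∷ βs) (db ∷ dbs) lb) lb< ⊆b
      | half {d} {ks} x∈d (chain (δ ∷ δs) (dd ∷ dds) ld) ld< ⊆c =
    ((b ++ list) ∷ hs) ʳ++ (d ∷ ks) ,
    chain (all-ʳ++ ((b ++ list) ∷ hs) (bigBranch ∷ βs) (δ ∷ δs))
          (allPairs-ʳ++ disj-sym ((b ++ list) ∷ hs) (All.tabulate bigDisj ∷ dbs) (dd ∷ dds) cross)
          (linked-ʳ++ adj-sym (link lb) ld (y , x , ∈-++⁺ʳ b y∈ , x∈d , e)) ,
    ≤-trans bound (≤-reflexive (sym (length-ʳ++ ((b ++ list) ∷ hs))))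
    where
    open Trim t
    y∈ : y ∈ list
    y∈ = walk-head walk
    bigBranch : Branch S Z (b ++ list)
    bigBranch = branch (conn-++ cn (trim-conn t) z∈b end∈) r r∈S (∈-++⁺ˡ r∈)
      λ v∈ → [ wi , proj₁ ∘ allP ]′ (∈-++⁻ b v∈)
    bigDisj : ∀ {h} → h ∈ hs → Disj (b ++ list) h
    bigDisj h∈ v∈ v∈h with ∈-++⁻ b v∈
    ... | inj₁ v∈b = All.lookup db h∈ v∈b v∈h
    ... | inj₂ v∈l with only v∈l (∈-concat⁺′ v∈h (⊆b (there h∈)))
    ... | refl = All.lookup db h∈ z∈b v∈h
    cross : ∀ {h k} → h ∈ (b ++ list) ∷ hs → k ∈ d ∷ ks → Disj h k
    cross (here refl) k∈ v∈ v∈k = [ (λ v∈b → dj (∈-concat⁺′ v∈b (⊆b (here refl))) v∈cs)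
                                  , (λ v∈l → proj₂ (allP v∈l) v∈cs) ]′ (∈-++⁻ b v∈)
      where v∈cs = ∈-concat⁺′ v∈k (⊆c k∈)
    cross (there h∈) k∈ v∈ v∈k = dj (∈-concat⁺′ v∈ (⊆b (there h∈))) (∈-concat⁺′ v∈k (⊆c k∈))
    link : ∀ {hs} → Linked Adj (b ∷ hs) → Linked Adj ((b ++ list) ∷ hs)
    link [-]     = [-]
    link ((u , v , u∈ , v∈ , e) ∷ l) = (u , v , ∈-++⁺ˡ u∈ , v∈ , e) ∷ l
    bound : suc m ≤ length ((b ++ list) ∷ hs) + length (d ∷ ks)
    bound with ≤-total (length (b ∷ hs)) (length (d ∷ ks))
    ... | inj₁ b≤d = ≤-trans (s≤s m≤b) (≤-trans lb< (+-monoʳ-≤ (length (b ∷ hs)) b≤d))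
    ... | inj₂ d≤b = ≤-trans (s≤s m≤c) (≤-trans ld< (+-monoˡ-≤ (length (d ∷ ks)) d≤b))

-- Covering S by an elimination tree of triangular depth

-- The number `k(k+1)/2` in the form that the induction produces: `suc k` removed vertices above a
-- tree for `k`.
triangle : ℕ → ℕ
triangle zero    = 0
triangle (suc k) = suc k + triangle k

module Rooted {n : ℕ} (E : Fin n → Fin n → Set) (E? : ∀ u v → Dec (E u v))
              (E-sym : ∀ {u v} → E u v → E v u) where

  private V = Fin n

  open Chains E E-sym

  closure-closed : ∀ {P A} (cl : Closure E E? P A) → let open Closure cl in
                   ∀ {x y} → x ∈ reached → E x y → P y → y ∈ reached
  closure-closed cl x∈ e p = let a , a∈ , w = sound x∈ in compl a∈ (walk-snoc w e p)
    where open Closure cl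

  closure-conn : ∀ {P c} (cl : Closure E E? P (c ∷ [])) → Conn (Closure.reached cl)
  closure-conn {P} {c} cl = conn-from inner
    where
    open Closure cl
    inner : ∀ {v} → v ∈ reached → Walk E (_∈ reached) c v
    inner v∈ with sound v∈
    ... | _ , here refl , w = walk-closed
      (λ r e p → walk-snoc r e (closure-closed cl (walk-last r) e p))
      (stop (compl (here refl) (stop (walk-head w)))) w

  infixl 6 _∖_
  _∖_ : List V → List V → List V
  Z ∖ Y = filter (λ v → ¬? (v ∈? Y)) Z

  ∈-∖⁺ : ∀ {Z Y v} → v ∈ Z → v ∉ Y → v ∈ Z ∖ Y
  ∈-∖⁺ {Y = Y} = ∈-filter⁺ (λ v → ¬? (v ∈? Y))

  ∈-∖⁻ : ∀ Z Y {v} → v ∈ Z ∖ Y → v ∈ Z × v ∉ Y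
  ∈-∖⁻ Z Y = ∈-filter⁻ (λ v → ¬? (v ∈? Y)) {xs = Z}

  record Splits (Z D D′ : List V) : Set where
    field
      left⊆    : ∀ {x} → x ∈ D → x ∈ Z
      right⊆   : ∀ {x} → x ∈ D′ → x ∈ Z
      disjoint : Disj D D′
      cover    : ∀ {x} → x ∈ Z → x ∈ D ⊎ x ∈ D′
      no-edge  : ∀ {x y} → x ∈ D → y ∈ D′ → ¬ E x y

  -- Induction on the length of the list: the component of its first vertex is split off.
  by-components : ∀ {ℓ} (R : List V → Set ℓ) →
    R [] →
    (∀ {Z D D′} → Splits Z D D′ → R D → R D′ → R Z) →
    ∀ Z → (∀ {D c} → (∀ {x} → x ∈ D → x ∈ Z) → c ∈ D → Conn D → R D) → R Z
  by-components R none both Z = loop (suc (length Z)) Z ≤-refl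
    where
    loop : ∀ f Z → length Z < f → (∀ {D c} → (∀ {x} → x ∈ D → x ∈ Z) → c ∈ D → Conn D → R D) → R Z
    loop _ [] _ _ = none
    loop (suc f) Z@(c ∷ _) (s≤s lt) one =
      both splits (one D⊆Z c∈D (closure-conn cl))
        (loop f (Z ∖ D) (≤-trans (filter-notAll (λ v → ¬? (v ∈? D)) Z (here (λ c∉ → c∉ c∈D))) lt)
          (λ ⊆ → one (proj₁ ∘ ∈-∖⁻ Z D ∘ ⊆)))
      where
      cl : Closure E E? (_∈ Z) (c ∷ [])
      cl = closure E E? (_∈? Z) (c ∷ [])
      open Closure cl renaming (reached to D)
      D⊆Z : ∀ {x} → x ∈ D → x ∈ Z
      D⊆Z x∈ = walk-last (proj₂ (proj₂ (sound x∈)))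
      c∈D : c ∈ D
      c∈D = compl (here refl) (stop (here refl))
      splits : Splits Z D (Z ∖ D)
      splits = record
        { left⊆ = D⊆Z; right⊆ = proj₁ ∘ ∈-∖⁻ Z D; disjoint = λ x∈ x∈′ → proj₂ (∈-∖⁻ Z D x∈′) x∈
        ; cover = λ {x} x∈ → case x ∈? D of λ { (yes x∈D) → inj₁ x∈D ; (no x∉D) → inj₂ (∈-∖⁺ x∈ x∉D) }
        ; no-edge = λ x∈ y∈ e → let y∈Z , y∉D = ∈-∖⁻ Z D y∈ in y∉D (closure-closed cl x∈ e y∈Z) }

  -- A tree of depth at most d with m removed vertices that covers all of S ∩ Z.
  data Elim (S : List V) : ℕ → ℕ → (V → Set) → Set₁ where
    leaf  : ∀ {d Z} → (∀ {x} → Z x → x ∉ S) → Elim S d 0 Z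
    node  : ∀ {d m Z Z′} v → (∀ {x} → Z x → x ≡ v ⊎ Z′ x) → Elim S d m Z′ → Elim S (suc d) (suc m) Z
    split : ∀ {d m₁ m₂ Z Z₁ Z₂} → (∀ {x} → Z x → Z₁ x ⊎ Z₂ x) → (∀ {x y} → Z₁ x → Z₂ y → ¬ E x y) →
            Elim S d m₁ Z₁ → Elim S d m₂ Z₂ → Elim S d (m₁ + m₂) Z

  elim-⊆ : ∀ {S d m Z Z′} → (∀ {x} → Z′ x → Z x) → Elim S d m Z → Elim S d m Z′
  elim-⊆ f (leaf ∉S)       = leaf (∉S ∘ f)
  elim-⊆ f (node v c t)    = node v (c ∘ f) t
  elim-⊆ f (split c e t u) = split (c ∘ f) e t u

  elim-≤ : ∀ {S d d′ m Z} → d ≤ d′ → Elim S d m Z → Elim S d′ m Z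
  elim-≤ le       (leaf ∉S)       = leaf ∉S
  elim-≤ (s≤s le) (node v c t)    = node v c (elim-≤ le t)
  elim-≤ le       (split c e t u) = split c e (elim-≤ le t) (elim-≤ le u)

  elim-nodes : ∀ {S d m} Y {Z} → Elim S d m (λ x → Z x × x ∉ Y) → Elim S (length Y + d) (length Y + m) Z
  elim-nodes []      t = elim-⊆ (λ c → c , λ ()) t
  elim-nodes {S} (y ∷ Y) {Z} t = node {Z′ = λ x → Z x × x ≢ y} y
    (λ {x} c → case x ≟ y of λ { (yes eq) → inj₁ eq ; (no ≢y) → inj₂ (c , ≢y) })
    (elim-nodes Y (elim-⊆ (λ { ((c , ≢y) , ∉Y) → c , λ { (here eq) → ≢y eq ; (there y∈) → ∉Y y∈ } }) t))

  -- The walk meets the path only in the head `e`, so its vertices can be put in front one at a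
  -- time, its far end becoming the new head.
  extend : ∀ {P e v qs} (w : Walk E P e v) → Unique (verts w) → Unique (e ∷ qs) → Linked E (e ∷ qs) →
           (∀ {z} → z ∈ verts w → z ∈ e ∷ qs → z ≡ e) →
           ∃[ qs′ ] Unique (v ∷ qs′) × Linked E (v ∷ qs′) × (∀ {z} → z ∈ e ∷ qs → z ∈ v ∷ qs′)
             × (∀ {z} → z ∈ v ∷ qs′ → z ∈ e ∷ qs ⊎ z ∈ verts w)
  extend {qs = qs} (stop _) _ uq lk _ = qs , uq , lk , id , inj₁
  extend {e = e} {qs = qs} (go {w = e′} _ edge w) (e# ∷ uw) uq lk only =
    let qs′ , uq′ , lk′ , old , new = extend w uw (fresh ∷ uq) (E-sym edge ∷ lk) only′
    in qs′ , uq′ , lk′ , old ∘ there , λ z∈ → back (new z∈)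
    where
    e∉ : e ∉ verts w
    e∉ e∈ = All.lookup e# e∈ refl
    first : ∀ {P u v} (w : Walk E P u v) → u ∈ verts w
    first (stop _)   = here refl
    first (go _ _ _) = here refl
    fresh : All (e′ ≢_) (e ∷ qs)
    fresh = All.tabulate λ { z∈ refl → e∉ (subst (_∈ verts w) (only (there (first w)) z∈) (first w)) }
    only′ : ∀ {z} → z ∈ verts w → z ∈ e′ ∷ e ∷ qs → z ≡ e′
    only′ z∈ (here eq)  = eq
    only′ z∈ (there z∈′) = contradiction (subst (_∈ verts w) (only (there z∈) z∈′) z∈) e∉
    back : ∀ {z} → z ∈ e′ ∷ e ∷ qs ⊎ z ∈ verts w → z ∈ e ∷ qs ⊎ z ∈ e ∷ verts w
    back (inj₁ (here refl)) = inj₂ (there (first w))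
    back (inj₁ (there z∈))  = inj₁ z∈
    back (inj₂ z∈)          = inj₂ (there z∈)

  module _ (S : List V) where

    Dichotomy : ℕ → List V → Set₁
    Dichotomy k Z = (∃[ bs ] Chain S Z bs × suc k ≤ length bs) ⊎ (∃[ m ] Elim S (triangle k) m (_∈ Z))

    module _ (Z : List V) where

      edgesIn : List (V × V)
      edgesIn = filter (λ (u , v) → E? u v) (cartesianProduct Z Z)

      edgesIn⁺ : ∀ {u v} → u ∈ Z → v ∈ Z → E u v → EdgeOf edgesIn u v
      edgesIn⁺ u∈ v∈ e = inj₁ (∈-filter⁺ (λ (u , v) → E? u v) (∈-cartesianProduct⁺ u∈ v∈) e)

      edgesIn⁻ : ∀ {u v} → EdgeOf edgesIn u v → u ∈ Z × v ∈ Z × E u v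
      edgesIn⁻ (inj₁ e) = let uv∈ , e′ = ∈-filter⁻ (λ (u , v) → E? u v) {xs = cartesianProduct Z Z} e
                              u∈ , v∈ = ∈-cartesianProduct⁻ Z Z uv∈ in u∈ , v∈ , e′
      edgesIn⁻ (inj₂ e) = let uv∈ , e′ = ∈-filter⁻ (λ (u , v) → E? u v) {xs = cartesianProduct Z Z} e
                              u∈ , v∈ = ∈-cartesianProduct⁻ Z Z uv∈ in v∈ , u∈ , E-sym e′

      walk-in : ∀ {P u v} → u ∈ Z → Walk (EdgeOf edgesIn) P u v → Walk E (λ x → P x × x ∈ Z) u v
      walk-in u∈ (stop p)   = stop (p , u∈)
      walk-in u∈ (go p e w) = let _ , w∈ , e′ = edgesIn⁻ e in go (p , u∈) e′ (walk-in w∈ w)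

      walk-out : ∀ {P u v} → Walk E (λ x → P x × x ∈ Z) u v → Walk (EdgeOf edgesIn) P u v
      walk-out (stop (p , _))    = stop p
      walk-out (go (p , u∈) e w) = go p (edgesIn⁺ u∈ (proj₂ (walk-head w)) e) (walk-out w)

      -- Cutting each path at its first vertex in `Q` makes that vertex the only one there, which is
      -- what a foot has to be.
      linkage⇒legs : ∀ {Q k} → Linkage edgesIn (filter (_∈? S) Z) Q k → Legs S Z Q k
      linkage⇒legs {Q} {k} Λ = record
        { leg = list; foot = λ i → end i; foot∈Q = end∈X; foot∈ = end∈
        ; branches = λ i → branch (trim-conn (t i)) (src i) (proj₂ (root i)) (walk-head (Trim.walk (t i)))
                             (proj₂ ∘ allP i)
        ; only = λ {i} → only i; disjoint = λ p q → disjoint (proj₁ (allP _ p)) (proj₁ (allP _ q)) }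
        where
        open Linkage Λ
        root : ∀ i → src i ∈ Z × src i ∈ S
        root i = ∈-filter⁻ (_∈? S) {xs = Z} (src∈ i)
        t : ∀ i → Trim E (λ x → x ∈ path i × x ∈ Z) Q (src i)
        t i = trim Q (walk-in (proj₁ (root i)) (walk i)) (tgt∈ i)
        open module T i = Trim (t i) using (list; end; end∈X; end∈; only; allP)

    module _ {k : ℕ} (smaller : ∀ Z → Dichotomy k Z) {Z : List V} (conZ : Conn Z) where

      -- The path `e ∷ qs` meets the current chain `bs` only in its head. If a separator `Y` of `S`
      -- from the path misses another chain `cs` with at least `suc k` branches, then either `cs`
      -- misses `bs` and the two are joined, or `cs` is reached from `e` through `bs`; in that case
      -- the path grows and `cs` replaces `bs`.
      search : ∀ f {bs e qs} → n < card (e ∷ qs) + f → Chain S Z bs → suc k ≤ length bs →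
               e ∈ concat bs → (∀ {z} → z ∈ concat bs → z ∈ e ∷ qs → z ≡ e) →
               (∀ {z} → z ∈ e ∷ qs → z ∈ Z) → Unique (e ∷ qs) → Linked E (e ∷ qs) → Dichotomy (suc k) Z
      search zero {qs = qs} lt _ _ _ _ _ _ _ =
        contradiction (card≤n (_ ∷ qs)) (<⇒≱ (subst (n <_) (+-identityʳ _) lt))
      search (suc f) {bs} {e} {qs} lt Bs long e∈ only Q⊆Z uq lk
        with menger (edgesIn Z) (filter (_∈? S) Z) (e ∷ qs) (suc (suc k))
      ... | inj₂ Λ = inj₁ (legs⇒chain Q⊆Z (linkage⇒legs Z Λ) uq lk)
      ... | inj₁ (Y , s≤s Y≤ , sep) with smaller (Z ∖ Y)
      -- No such chain is left off `Y`: its at most `suc k` vertices go on top of a tree of depth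
      -- `triangle k`.
      ... | inj₂ (m , t) = inj₂ (_ , elim-≤ (+-monoˡ-≤ (triangle k) Y≤)
              (elim-nodes Y (elim-⊆ (λ (x∈ , x∉) → ∈-∖⁺ x∈ x∉) t)))
      ... | inj₁ (cs@(c ∷ cs′) , Cs@(chain (γ ∷ _) _ _) , long′) =
        meet (Any.any? (_∈? concat cs) (concat bs))
        where
        Cs′ : Chain S Z cs
        Cs′ = chain-widen (proj₁ ∘ ∈-∖⁻ Z Y) Cs
        r∈ : Branch.root γ ∈ concat cs
        r∈ = ∈-++⁺ˡ (Branch.root∈ γ)
        r∈Z∖Y = Branch.within γ (Branch.root∈ γ)
        -- The chain `cs` is connected, contains a vertex of `S` and avoids `Y`, so it cannot reach
        -- the path.
        avoids : Disj (concat cs) (e ∷ qs)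
        avoids v∈ v∈Q = sep (∈-filter⁺ (_∈? S) (proj₁ (∈-∖⁻ Z Y r∈Z∖Y)) (Branch.root∈S γ)) v∈Q
          (walk-out Z (widen
            (λ x∈ → let x∈Z , x∉Y = ∈-∖⁻ Z Y (concat-within (Chain.branches Cs) x∈) in x∉Y , x∈Z)
            (chain-concat Cs r∈ v∈)))
        meet : Dec (Any.Any (_∈ concat cs) (concat bs)) → Dichotomy (suc k) Z
        meet (no none) = inj₁ (chain-join conZ Bs Cs′ long long′
          (λ v∈ v∈′ → none (Any.map (λ { refl → v∈′ }) v∈)) e∈ r∈)
        meet (yes hit) with find hit
        ... | z , z∈b , z∈c with trim (concat cs) (conn-chain Bs e∈ z∈b) z∈c
          where
          conn-chain : ∀ {bs} → Chain S Z bs → Conn (concat bs)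
          conn-chain {_ ∷ _} c = chain-concat c
          conn-chain {[]}    c ()
        ... | t with simple (Trim.walk t)
        ... | w , uw with extend w uw uq lk (λ z∈ → only (Trim.allP t (verts-P w z∈)))
        -- The new head lies in `cs`, hence off the old path: the path has become strictly larger.
        ... | qs′ , uq′ , lk′ , old , new = search f
              (≤-trans lt (≤-trans (≤-reflexive (+-suc _ f))
                (+-monoˡ-≤ f (card-< old (avoids (Trim.end∈X t)) (here refl)))))
              Cs′ long′ (Trim.end∈X t)
              (λ z∈ z∈Q → [ (λ z∈old → contradiction z∈old (avoids z∈))
                          , (λ z∈w → Trim.only t (verts-P w z∈w) z∈) ]′ (new z∈Q))
              (λ z∈ → [ Q⊆Z , concat-within (Chain.branches Bs) ∘ Trim.allP t ∘ verts-P w ]′ (new z∈))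
              uq′ lk′

    -- Trees of separate components stand side by side without adding depth, so connected sets
    -- suffice. There a chain for `k` starts `search`, with the root of its first branch as a path
    -- of one vertex.
    dichotomy : ∀ k Z → Dichotomy k Z
    dichotomy zero Z with Any.any? (_∈? S) Z
    ... | no none = inj₂ (0 , leaf λ x∈ x∈S → none (Any.map (λ { refl → x∈S }) x∈))
    ... | yes some = let c , c∈ , c∈S = find some in inj₁
      ((c ∷ []) ∷ [] , chain (branch (λ { (here refl) (here refl) → stop (here refl) }) c c∈S (here refl)
        (λ { (here refl) → c∈ }) ∷ []) ([] ∷ []) [-] , s≤s z≤n)
    dichotomy (suc k) Z = by-components (Dichotomy (suc k)) (inj₂ (0 , leaf λ ()))
      (λ { sp (inj₁ (bs , c , l)) _ → inj₁ (bs , chain-widen (Splits.left⊆ sp) c , l)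
         ; sp (inj₂ _) (inj₁ (bs , c , l)) → inj₁ (bs , chain-widen (Splits.right⊆ sp) c , l)
         ; sp (inj₂ (_ , t)) (inj₂ (_ , u)) →
             inj₂ (_ , split (Splits.cover sp) (Splits.no-edge sp) t u) })
      Z (λ _ _ → connected)
      where
      connected : ∀ {D} → Conn D → Dichotomy (suc k) D
      connected {D} conD with dichotomy k D
      ... | inj₂ (m , t) = inj₂ (m , elim-≤ (m≤n+m _ (suc k)) t)
      ... | inj₁ (b ∷ bs , c@(chain (β ∷ _) _ _) , long) =
        search (dichotomy k) conD (suc n) (m≤n+m (suc n) _) c long (∈-++⁺ˡ (Branch.root∈ β))
          (λ { _ (here eq) → eq ; _ (there ()) })
          (λ { (here refl) → Branch.within β (Branch.root∈ β) ; (there ()) })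
          ([] ∷ []) [-]

-- Building the elimination forest layer by layer

-- Membership in `D` is a decidable substitute for the choice that `f` makes between `P` and `Q`.
choose : ∀ {A : Set} {P Q : A → Set} Z → (∀ {x} → x ∈ Z → P x ⊎ Q x) →
         ∃[ D ] (∀ {x} → x ∈ D → x ∈ Z × P x) × (∀ {x} → x ∈ Z → x ∉ D → Q x)
choose []      f = [] , (λ ()) , (λ ())
choose (c ∷ Z) f with choose Z (f ∘ there) | f (here refl)
... | D , l , r | inj₁ p = c ∷ D
  , (λ { (here refl) → here refl , p ; (there x∈) → let x∈Z , q = l x∈ in there x∈Z , q })
  , (λ { (here refl) x∉ → contradiction (here refl) x∉ ; (there x∈) x∉ → r x∈ (x∉ ∘ there) })
... | D , l , r | inj₂ q = D
  , (λ x∈ → let x∈Z , p = l x∈ in there x∈Z , p)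
  , (λ { (here refl) _ → q ; (there x∈) x∉ → r x∈ x∉ })

-- Nearest ancestor first, each with the index of its layer.
Ancestors : Set → Set
Ancestors V = List (V × ℕ)

labelled? : ∀ {V : Set} i (x : V × ℕ) → Dec (proj₂ x ≡ i)
labelled? i (_ , ℓ) = ℓ ℕ.≟ i

count : ∀ {V : Set} → ℕ → Ancestors V → ℕ
count i anc = length (filter (labelled? i) anc)

count-∷-≡ : ∀ {V : Set} {v : V} {ℓ} anc → count ℓ ((v , ℓ) ∷ anc) ≡ suc (count ℓ anc)
count-∷-≡ {ℓ = ℓ} anc = cong length (filter-accept (labelled? ℓ) {xs = anc} refl)

count-∷-≢ : ∀ {V : Set} {v : V} {i ℓ} anc → ℓ ≢ i → count i ((v , ℓ) ∷ anc) ≡ count i anc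
count-∷-≢ {i = i} anc ≢i = cong length (filter-reject (labelled? i) {xs = anc} ≢i)

count-∷-≤ : ∀ {V : Set} {v : V} {ℓ W} i anc → (ℓ ≡ i → suc (count i anc) ≤ W) → count i anc ≤ W →
            count i ((v , ℓ) ∷ anc) ≤ W
count-∷-≤ {ℓ = ℓ} i anc eq≤ ≤W with ℓ ℕ.≟ i
... | yes refl = ≤-trans (≤-reflexive (count-∷-≡ anc)) (eq≤ refl)
... | no ≢i    = ≤-trans (≤-reflexive (count-∷-≢ anc ≢i)) ≤W

count-above : ∀ {V : Set} {ℓ} (anc : Ancestors V) → (∀ {a ℓa} → (a , ℓa) ∈ anc → ℓa ≤ ℓ) →
              count (suc ℓ) anc ≡ 0
count-above anc below = cong length (filter-none (labelled? _) {xs = anc}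
  (All.tabulate λ { a∈ refl → 1+n≰n (below a∈) }))

Close : ℕ → ℕ → Set
Close i j = i ≤ suc j × j ≤ suc i

module Layered {n : ℕ} (E : Fin n → Fin n → Set) (E? : ∀ u v → Dec (E u v))
               (E-sym : ∀ {u v} → E u v → E v u) where

  private V = Fin n

  open Chains E E-sym
  open Rooted E E? E-sym

  -- The elimination forest and its layering are built together: each new vertex is checked against
  -- the labelled vertices `anc` above it, both for the layering and for the width.
  data Forest (W : ℕ) : Ancestors V → List V → Set where
    done  : ∀ {anc} → Forest W anc []
    node  : ∀ {anc Z} v ℓ → v ∈ Z → (∀ {a ℓa} → (a , ℓa) ∈ anc → E a v → Close ℓa ℓ) →
            (∀ i → count i ((v , ℓ) ∷ anc) ≤ W) →
            Forest W ((v , ℓ) ∷ anc) (Z ∖ (v ∷ [])) → Forest W anc Z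
    split : ∀ {anc Z D D′} → Splits Z D D′ → Forest W anc D → Forest W anc D′ → Forest W anc Z

  -- `D` is still to be placed. All ancestors adjacent to `D` lie in layer `ℓ`, the highest so far,
  -- and in the connected set `U`, the prospective centre of a fan; `U` may also contain vertices
  -- that are no ancestors.
  record Region (W : ℕ) (D U : List V) (anc : Ancestors V) (ℓ : ℕ) : Set where
    field
      conD   : Conn D
      conU   : Conn U
      U#D    : Disj U D
      border : ∀ {a ℓa c} → (a , ℓa) ∈ anc → c ∈ D → E a c → ℓa ≡ ℓ × a ∈ U
      counts : ∀ i → count i anc ≤ W
      below  : ∀ {a ℓa} → (a , ℓa) ∈ anc → ℓa ≤ ℓ
      anc#D  : ∀ {a ℓa} → (a , ℓa) ∈ anc → a ∉ D

  module Layer {W ℓ : ℕ} {D U : List V} {anc : Ancestors V} (region : Region W D U anc ℓ)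
               {u₀ s₀ : V} (u₀∈U : u₀ ∈ U) (s₀∈D : s₀ ∈ D)
               (S : List V) (s₀∈S : s₀ ∈ S)
               (S⁺ : ∀ {u v} → u ∈ U → v ∈ D → E u v → v ∈ S)
               (S⁻ : ∀ {v} → v ∈ S → ∃[ u ] u ∈ U × E u v)
               (next : ∀ {D′ U′ anc′ c} → card D′ < card D → c ∈ D′ → Region W D′ U′ anc′ (suc ℓ) →
                       Forest W anc′ D′) where

    open Region region

    -- `d` is the depth that the remaining tree may still use in layer `suc ℓ`; all vertices placed
    -- since the layer was begun carry that label.
    record State (d : ℕ) (anc′ : Ancestors V) (Z : List V) : Set where
      field
        sub  : ∀ {x} → x ∈ Z → x ∈ D
        room : count (suc ℓ) anc′ + d ≤ W
        cnts : ∀ i → count i anc′ ≤ W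
        old  : ∀ {a ℓa} → (a , ℓa) ∈ anc′ → (a , ℓa) ∈ anc ⊎ (ℓa ≡ suc ℓ × a ∈ D × a ∉ Z)

    -- K hangs off the rest of D at D′ only and does not touch U: it may be merged into the
    -- part D′ that is left over, which removes fewer vertices.
    record Merge (d m : ℕ) (Zt : V → Set) (anc′ : Ancestors V) (Z : List V) : Set₁ where
      field
        {m′}   : ℕ
        D′ K   : List V
        D′⊆Z   : ∀ {x} → x ∈ D′ → x ∈ Z
        K⊆D    : ∀ {x} → x ∈ K → x ∈ D
        closed : ∀ {x y} → x ∈ K → y ∈ D → E x y → y ∈ D′ ⊎ y ∈ K
        tree   : Elim S d m′ (λ x → x ∈ D × (Zt x ⊎ x ∈ K))
        -- The second case turns into the first at the node of the tree that removes a.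
        less   : m′ < m ⊎ (m′ ≤ m × ∃[ a ] ∃[ ℓa ] (a , ℓa) ∈ anc′ × a ∈ K)

      ≤m : m′ ≤ m
      ≤m = [ <⇒≤ , proj₁ ]′ less

    outside : ∀ D′ → Closure E E? (λ v → v ∈ U ++ D × v ∉ D′) (u₀ ∷ [])
    outside D′ = closure E E? (λ v → v ∈? (U ++ D) ×-dec ¬? (v ∈? D′)) (u₀ ∷ [])

    -- Let `U′` be what is connected to `u₀` within `U` and `D`, off `D′`. If all ancestors in `D`
    -- with a neighbour in `D′` lie in `U′`, then `D′` is a region for the next layer. Otherwise `K`
    -- is the component in `D` minus `D′` of such an ancestor outside `U′`; it misses `S` and so
    -- fits into a leaf.
    merge-part : ∀ {d Zt anc′ Z} → State d anc′ Z → (∀ {x} → x ∈ Z → Zt x) → (∀ {x} → Zt x → x ∉ S) →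
                 ∀ {D′ c} → (∀ {x} → x ∈ D′ → x ∈ Z) → c ∈ D′ → Conn D′ →
                 Forest W anc′ D′ ⊎ Merge d 0 Zt anc′ Z
    merge-part {d} {Zt} {anc′} {Z} st Z⊆ ∉S {D′} D′⊆Z c∈ conD′
      with Any.any? (λ (a , _) → ¬? (a ∈? U′) ×-dec (a ∈? D ×-dec Any.any? (E? a) D′)) anc′
      where U′ = Closure.reached (outside D′)
    ... | no none = inj₁ (next card′ c∈ record
      { conD = conD′; conU = closure-conn (outside D′)
      ; U#D = λ v∈ → proj₂ (walk-last (proj₂ (proj₂ (sound v∈))))
      ; border = border′
      ; counts = cnts
      ; below = λ a∈ → [ m≤n⇒m≤1+n ∘ below , (λ { (refl , _) → ≤-refl }) ]′ (old a∈)
      ; anc#D = λ a∈ a∈D′ → [ (λ a∈anc → anc#D a∈anc (sub (D′⊆Z a∈D′)))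
                            , (λ { (_ , _ , a∉) → a∉ (D′⊆Z a∈D′) }) ]′ (old a∈) })
      where
      open State st
      open Closure (outside D′)
      -- The leaf misses `S`, so `s₀` is in `D` but not in `D′`.
      card′ : card D′ < card D
      card′ = card-< (sub ∘ D′⊆Z) (λ s₀∈ → ∉S (Z⊆ (D′⊆Z s₀∈)) s₀∈S) s₀∈D
      border′ : ∀ {a ℓa c} → (a , ℓa) ∈ anc′ → c ∈ D′ → E a c → ℓa ≡ suc ℓ × a ∈ reached
      border′ {a} a∈ c∈ e with old a∈
      -- An earlier ancestor with a neighbour in `D` lies in `U`, which puts that neighbour into
      -- `S`; the leaf misses `S`.
      ... | inj₁ a∈anc = contradiction (S⁺ (proj₂ (border a∈anc (sub (D′⊆Z c∈)) e)) (sub (D′⊆Z c∈)) e)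
                           (∉S (Z⊆ (D′⊆Z c∈)))
      ... | inj₂ (refl , a∈D , _) = refl , decidable-stable (a ∈? reached) λ a∉ →
              none (Any.map (λ { refl → a∉ , a∈D , Any.map (λ { refl → e }) c∈ }) a∈)
    ... | yes some with find some
    ... | (a , ℓa) , a∈ , a∉U′ , a∈D , adjD′ = inj₂ record
      { D′ = D′; K = K; D′⊆Z = D′⊆Z; K⊆D = λ x∈ → proj₁ (inK x∈)
      ; closed = λ {x} {y} x∈ y∈ e → case y ∈? D′ of λ
          { (yes y∈D′) → inj₁ y∈D′ ; (no y∉) → inj₂ (closure-closed clK x∈ e (y∈ , y∉)) }
      ; tree = leaf λ { (_ , inj₁ c) → ∉S c ; (_ , inj₂ x∈) → K∉S x∈ }
      ; less = inj₂ (z≤n , a , ℓa , a∈ , Closure.compl clK (here refl) (stop (a∈D , a∉D′))) }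
      where
      open State st
      clK = closure E E? {P = λ v → v ∈ D × v ∉ D′} (λ v → v ∈? D ×-dec ¬? (v ∈? D′)) (a ∷ [])
      K = Closure.reached clK
      inK : ∀ {x} → x ∈ K → x ∈ D × x ∉ D′
      inK x∈ = walk-last (proj₂ (proj₂ (Closure.sound clK x∈)))
      a∉D′ : a ∉ D′
      a∉D′ a∈D′ = [ (λ a∈anc → anc#D a∈anc a∈D) , (λ { (_ , _ , a∉) → a∉ (D′⊆Z a∈D′) }) ]′ (old a∈)
      -- A vertex of `S` in `K` would connect `a` with `u₀` through `U`, off `D′`, and put `a` into
      -- `U′`.
      K∉S : ∀ {x} → x ∈ K → x ∉ S
      K∉S x∈ x∈S with S⁻ x∈S | Closure.sound clK x∈
      ... | u , u∈ , e | _ , here refl , w = a∉U′ (Closure.compl (outside D′) (here refl)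
        (widen (λ v∈ → ∈-++⁺ˡ v∈ , U#D v∈ ∘ sub ∘ D′⊆Z) (conU u₀∈U u∈)
          ▷ go (∈-++⁺ˡ u∈ , U#D u∈ ∘ sub ∘ D′⊆Z) e
               (widen (λ (v∈ , v∉) → ∈-++⁺ʳ U v∈ , v∉) (walk-rev E-sym w))))

    -- The tree is followed downwards and its removed vertices are placed in layer `suc ℓ`. A merge
    -- found at a leaf is carried back up instead of a forest, the tree being rebuilt around `K`.
    build : ∀ {d m Zt} → Elim S d m Zt → ∀ {anc′ Z} → State d anc′ Z → (∀ {x} → x ∈ Z → Zt x) →
            Forest W anc′ Z ⊎ Merge d m Zt anc′ Z
    build (leaf ∉S) {anc′} {Z} st Z⊆ = by-components (λ D′ → Forest W anc′ D′ ⊎ Merge _ 0 _ anc′ Z)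
      (inj₁ done)
      (λ { sp (inj₁ F) (inj₁ G) → inj₁ (split sp F G)
         ; sp (inj₂ M) _ → inj₂ M ; sp _ (inj₂ M) → inj₂ M })
      Z (merge-part st Z⊆ ∉S)
    build {suc d} {suc m} {Zt} (node {Z′ = Zt′} v cov t) {anc′} {Z} st Z⊆ with v ∈? Z
    ... | yes v∈ = result (build t st′ λ x∈ → let x∈Z , x≢ = ∈-∖⁻ Z (v ∷ []) x∈ in
                            [ (λ x≡ → contradiction (here x≡) x≢) , id ]′ (cov (Z⊆ x∈Z)))
      where
      open State st
      room′ : suc (count (suc ℓ) anc′) + d ≤ W
      room′ = ≤-trans (≤-reflexive (sym (+-suc _ d))) room
      cnts′ : ∀ i → count i ((v , suc ℓ) ∷ anc′) ≤ W
      cnts′ i = count-∷-≤ {v = v} {suc ℓ} i anc′ (λ { refl → ≤-trans (m≤m+n _ d) room′ }) (cnts i)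
      in-rest : ∀ {x} → x ∈ Z ∖ (v ∷ []) → x ∈ Z
      in-rest = proj₁ ∘ ∈-∖⁻ Z (v ∷ [])
      st′ : State d ((v , suc ℓ) ∷ anc′) (Z ∖ (v ∷ []))
      st′ = record
        { sub = sub ∘ in-rest
        ; room = ≤-trans (≤-reflexive (cong (_+ d) (count-∷-≡ anc′))) room′
        ; cnts = cnts′
        ; old = λ { (here refl) → inj₂ (refl , sub v∈ , λ v∈′ → proj₂ (∈-∖⁻ Z (v ∷ []) v∈′) (here refl))
                  ; (there a∈) → [ inj₁ , (λ (eq , a∈D , a∉) → inj₂ (eq , a∈D , a∉ ∘ in-rest)) ]′ (old a∈) } }
      close : ∀ {a ℓa} → (a , ℓa) ∈ anc′ → E a v → Close ℓa (suc ℓ)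
      close a∈ e with old a∈
      ... | inj₂ (refl , _) = n≤1+n _ , n≤1+n _
      ... | inj₁ a∈anc with border a∈anc (sub v∈) e
      ... | refl , _ = m≤n⇒m≤1+n (n≤1+n _) , ≤-refl
      result : Forest W ((v , suc ℓ) ∷ anc′) (Z ∖ (v ∷ [])) ⊎
                 Merge d m Zt′ ((v , suc ℓ) ∷ anc′) (Z ∖ (v ∷ [])) →
               Forest W anc′ Z ⊎ Merge (suc d) (suc m) Zt anc′ Z
      result (inj₁ F) = inj₁ (node v (suc ℓ) v∈ close cnts′ F)
      result (inj₂ M) with v ∈? Merge.K M
      -- The tree below already accounts for `K` and hence for `v`: this node is dropped, and the
      -- number of removed vertices falls.
      ... | yes v∈K = inj₂ record
        { Merge M; D′⊆Z = in-rest ∘ D′⊆Z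
        ; tree = elim-≤ (n≤1+n d) (elim-⊆ (λ
            { (x∈ , inj₁ c) → x∈ , [ (λ { refl → inj₂ v∈K }) , inj₁ ]′ (cov c)
            ; (x∈ , inj₂ k) → x∈ , inj₂ k }) tree)
        ; less = inj₁ (s≤s ≤m) }
        where open Merge M
      ... | no v∉K = inj₂ record
        { Merge M; D′⊆Z = in-rest ∘ D′⊆Z
        ; m′ = suc m′
        ; tree = node v (λ { (x∈ , inj₁ c) → [ inj₁ , (λ c′ → inj₂ (x∈ , inj₁ c′)) ]′ (cov c)
                           ; (x∈ , inj₂ k) → inj₂ (x∈ , inj₂ k) }) tree
        ; less = [ inj₁ ∘ s≤s
                 , (λ { (_ , _ , _ , here refl , k) → contradiction k v∉K
                      ; (le , a , ℓa , there a∈ , k) → inj₂ (s≤s le , a , ℓa , a∈ , k) }) ]′ less }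
        where open Merge M
    -- Nothing is placed here, and one unit of depth is forgone.
    ... | no v∉ = result (build t st′ λ x∈ → [ (λ { refl → contradiction x∈ v∉ }) , id ]′ (cov (Z⊆ x∈)))
      where
      open State st
      st′ : State d anc′ Z
      st′ = record { State st; room = ≤-trans (+-monoʳ-≤ _ (n≤1+n d)) room }
      result : Forest W anc′ Z ⊎ Merge d m Zt′ anc′ Z → Forest W anc′ Z ⊎ Merge (suc d) (suc m) Zt anc′ Z
      result (inj₁ F) = inj₁ F
      result (inj₂ M) = inj₂ record
        { Merge M
        ; m′ = suc m′
        ; tree = node v (λ { (x∈ , inj₁ c) → [ inj₁ , (λ c′ → inj₂ (x∈ , inj₁ c′)) ]′ (cov c)
                           ; (x∈ , inj₂ k) → inj₂ (x∈ , inj₂ k) }) tree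
        ; less = [ inj₁ ∘ s≤s , (λ (le , r) → inj₂ (s≤s le , r)) ]′ less }
        where open Merge M
    build {d} {Zt = Zt} (split {m₁ = m₁} {m₂} {Z₁ = Zt₁} {Zt₂} cov noe t u) {anc′} {Z} st Z⊆
      with choose Z (cov ∘ Z⊆)
    ... | Z₁ , left , right = result (build t (shrink (proj₁ ∘ left)) (proj₂ ∘ left))
                                     (build u (shrink (proj₁ ∘ in₂)) in-right)
      where
      open State st
      Z₂ = Z ∖ Z₁
      in₂ : ∀ {x} → x ∈ Z₂ → x ∈ Z × x ∉ Z₁
      in₂ = ∈-∖⁻ Z Z₁
      shrink : ∀ {Z′} → (∀ {x} → x ∈ Z′ → x ∈ Z) → State d anc′ Z′
      shrink f = record { sub = sub ∘ f; room = room; cnts = cnts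
        ; old = λ a∈ → [ inj₁ , (λ (eq , a∈D , a∉) → inj₂ (eq , a∈D , a∉ ∘ f)) ]′ (old a∈) }
      in-right : ∀ {x} → x ∈ Z₂ → Zt₂ x
      in-right x∈ = right (proj₁ (in₂ x∈)) (proj₂ (in₂ x∈))
      splits : Splits Z Z₁ Z₂
      splits = record
        { left⊆ = proj₁ ∘ left; right⊆ = proj₁ ∘ in₂; disjoint = λ x∈ x∈′ → proj₂ (in₂ x∈′) x∈
        ; cover = λ {x} x∈ → case x ∈? Z₁ of λ { (yes y) → inj₁ y ; (no x∉) → inj₂ (∈-∖⁺ x∈ x∉) }
        ; no-edge = λ x∈ y∈ → noe (proj₂ (left x∈)) (in-right y∈) }
      result : Forest W anc′ Z₁ ⊎ Merge d m₁ Zt₁ anc′ Z₁ → Forest W anc′ Z₂ ⊎ Merge d m₂ Zt₂ anc′ Z₂ →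
               Forest W anc′ Z ⊎ Merge d (m₁ + m₂) Zt anc′ Z
      result (inj₁ F) (inj₁ G) = inj₁ (split splits F G)
      -- `K` joins the side that contains `D′` and is taken from the other. No edge crosses, because
      -- the neighbours of `K` in `D` lie in `D′` or `K`.
      result (inj₂ M) _ = inj₂ record
        { Merge M; D′⊆Z = proj₁ ∘ left ∘ D′⊆Z
        ; m′ = m′ + m₂
        ; tree = split {Z₂ = λ x → Zt₂ x × x ∈ D × x ∉ K × x ∉ D′} side
            (λ { (_ , inj₁ c) (c₂ , _) → noe c c₂
               ; (_ , inj₂ x∈K) (_ , y∈ , y∉K , y∉D′) e → [ y∉D′ , y∉K ]′ (closed x∈K y∈ e) })
            tree (elim-⊆ proj₁ u)
        ; less = [ inj₁ ∘ +-monoˡ-< m₂ , (λ (le , r) → inj₂ (+-monoˡ-≤ m₂ le , r)) ]′ less }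
        where
        open Merge M
        side : ∀ {x} → x ∈ D × (Zt x ⊎ x ∈ K) →
               (x ∈ D × (Zt₁ x ⊎ x ∈ K)) ⊎ (Zt₂ x × x ∈ D × x ∉ K × x ∉ D′)
        side (x∈ , inj₂ k) = inj₁ (x∈ , inj₂ k)
        side {x} (x∈ , inj₁ c) with cov c | x ∈? K | x ∈? D′
        ... | inj₁ c₁ | _      | _       = inj₁ (x∈ , inj₁ c₁)
        ... | inj₂ _  | yes k  | _       = inj₁ (x∈ , inj₂ k)
        ... | inj₂ _  | no _   | yes x∈′ = inj₁ (x∈ , inj₁ (proj₂ (left (D′⊆Z x∈′))))
        ... | inj₂ c₂ | no x∉K | no x∉′  = inj₂ (c₂ , x∈ , x∉K , x∉′)
      result (inj₁ _) (inj₂ M) = inj₂ record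
        { Merge M; D′⊆Z = proj₁ ∘ in₂ ∘ D′⊆Z
        ; m′ = m₁ + m′
        ; tree = split {Z₁ = λ x → Zt₁ x × x ∈ D × x ∉ K × x ∉ D′} side
            (λ { (c₁ , _) (_ , inj₁ c) → noe c₁ c
               ; (_ , y∈ , y∉K , y∉D′) (_ , inj₂ x∈K) e → [ y∉D′ , y∉K ]′ (closed x∈K y∈ (E-sym e)) })
            (elim-⊆ proj₁ t) tree
        ; less = [ inj₁ ∘ +-monoʳ-< m₁ , (λ (le , r) → inj₂ (+-monoʳ-≤ m₁ le , r)) ]′ less }
        where
        open Merge M
        side : ∀ {x} → x ∈ D × (Zt x ⊎ x ∈ K) →
               (Zt₁ x × x ∈ D × x ∉ K × x ∉ D′) ⊎ (x ∈ D × (Zt₂ x ⊎ x ∈ K))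
        side (x∈ , inj₂ k) = inj₂ (x∈ , inj₂ k)
        side {x} (x∈ , inj₁ c) with cov c | x ∈? K | x ∈? D′
        ... | inj₂ c₂ | _      | _       = inj₂ (x∈ , inj₁ c₂)
        ... | inj₁ _  | yes k  | _       = inj₂ (x∈ , inj₂ k)
        ... | inj₁ _  | no _   | yes x∈′ = inj₂ (x∈ , inj₁ (in-right (D′⊆Z x∈′)))
        ... | inj₁ c₁ | no x∉K | no x∉′  = inj₁ (c₁ , x∈ , x∉K , x∉′)

    count-next : count (suc ℓ) anc ≡ 0
    count-next = count-above anc below

    -- A merge yields a tree on all of `D` of the same depth bound with fewer removed vertices, so
    -- rebuilding comes to an end.
    layer : ∀ f {m} → m < f → Elim S W m (_∈ D) → Forest W anc D
    layer (suc f) (s≤s m≤f) t with build t start id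
      where
      start : State W anc D
      -- No ancestor is in layer `suc ℓ` yet, so the whole depth `W` is available.
      start = record { sub = id; room = ≤-reflexive (cong (_+ W) count-next); cnts = counts; old = inj₁ }
    ... | inj₁ F = F
    ... | inj₂ M with Merge.less M
    ... | inj₁ m′<m = layer f (≤-trans m′<m m≤f) (elim-⊆ (λ x∈ → x∈ , inj₁ x∈) (Merge.tree M))
    -- All nodes placed in this layer have been passed, so `a` would be an earlier ancestor inside
    -- `D`.
    ... | inj₂ (_ , _ , _ , a∈ , a∈K) = contradiction (Merge.K⊆D M a∈K) (anc#D a∈)

  -- Recursion over regions

  module _ (k : ℕ)
    (no-fan : ∀ {U D S bs} → Conn U → Disj U D → (∀ {v} → v ∈ S → ∃[ u ] u ∈ U × E u v) →
              Chain S D bs → ¬ (suc (suc k) ≤ length bs)) where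

    private W = triangle (suc k)

    region-forest : ∀ f {D U anc ℓ c} → card D < f → c ∈ D → Region W D U anc ℓ → Forest W anc D
    region-forest (suc f) {D} {U} {anc} {ℓ} {c} (s≤s le) c∈ region
      with Any.any? (λ v → Any.any? (λ u → E? u v) U) D
    -- Without edges between `U` and `D`, no ancestor has a neighbour in `D`. Any vertex `c` may
    -- come next and serves as `U` for the components of the rest.
    ... | no none = node c (suc ℓ) c∈
      (λ a∈ e → contradiction (isolated c∈ (proj₂ (border a∈ c∈ e)) e) λ ())
      cnts′
      (by-components (Forest W ((c , suc ℓ) ∷ anc)) done split (D ∖ (c ∷ [])) λ {D′} ⊆ c′∈ con →
        let sub = λ {x} x∈ → ∈-∖⁻ D (c ∷ []) {x} (⊆ x∈)
            c∉ = λ c∈′ → proj₂ (sub c∈′) (here refl) in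
        region-forest f {U = c ∷ []} (≤-trans (card-< (proj₁ ∘ sub) c∉ c∈) le) c′∈ record
        { conD = con
        ; conU = λ { (here refl) (here refl) → stop (here refl) ; _ (there ()) ; (there ()) _ }
        ; U#D = λ { (here refl) → c∉ ; (there ()) }
        ; border = λ { (here refl) _ _ → refl , here refl
                     ; (there a∈) x∈ e → let x∈D = proj₁ (sub x∈) in
                         ⊥-elim (isolated x∈D (proj₂ (border a∈ x∈D e)) e) }
        ; counts = cnts′
        ; below = λ { (here refl) → ≤-refl ; (there a∈) → m≤n⇒m≤1+n (below a∈) }
        ; anc#D = λ { (here refl) → c∉ ; (there a∈) → anc#D a∈ ∘ proj₁ ∘ sub } })
      where
      open Region region
      isolated : ∀ {u v} → v ∈ D → u ∈ U → ¬ E u v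
      isolated v∈ u∈ e = none (Any.map (λ { refl → Any.map (λ { refl → e }) u∈ }) v∈)
      cnts′ : ∀ i → count i ((c , suc ℓ) ∷ anc) ≤ W
      cnts′ i = count-∷-≤ {v = c} {suc ℓ} i anc
        (λ { refl → ≤-trans (s≤s (≤-reflexive (count-above anc below))) (s≤s z≤n) }) (counts i)
    ... | yes some with find some
    ... | s₀ , s₀∈D , touch with find touch
    ... | u₀ , u₀∈U , e₀ = cases (dichotomy S (suc k) D)
      where
      open Region region
      touches? : ∀ v → Dec (Any.Any (λ u → E u v) U)
      touches? v = Any.any? (λ u → E? u v) U
      S : List V
      S = filter touches? D
      S⁺ : ∀ {u v} → u ∈ U → v ∈ D → E u v → v ∈ S
      S⁺ u∈ v∈ e = ∈-filter⁺ touches? v∈ (Any.map (λ { refl → e }) u∈)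
      S⁻ : ∀ {v} → v ∈ S → ∃[ u ] u ∈ U × E u v
      S⁻ v∈ = find (proj₂ (∈-filter⁻ touches? {xs = D} v∈))
      cases : Dichotomy S (suc k) D → Forest W anc D
      cases (inj₁ (bs , Bs , long)) = contradiction long (no-fan conU U#D S⁻ Bs)
      cases (inj₂ (m , t)) = Layer.layer region u₀∈U s₀∈D S (S⁺ u₀∈U s₀∈D e₀) S⁺ S⁻
        (λ lt → region-forest f (≤-trans lt le)) (suc m) ≤-refl t

    forest : ∀ Z → Forest W [] Z
    forest Z = by-components (Forest W []) done split Z λ {D} _ c∈ con →
      region-forest (suc (card D)) {U = []} {ℓ = 0} ≤-refl c∈ record
      { conD = con; conU = λ (); U#D = λ (); border = λ (); counts = λ _ → z≤n; below = λ (); anc#D = λ () }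

-- From nested ancestor lists to parent maps

module Realise {n : ℕ} (E : Fin n → Fin n → Set) (E? : ∀ u v → Dec (E u v))
               (E-sym : ∀ {u v} → E u v → E v u) (E-irrefl : ∀ {u} → ¬ E u u) {W : ℕ} where

  private V = Fin n

  open Rooted E E? E-sym
  open Layered E E? E-sym

  -- `w` itself comes first, then its ancestors; outside `Z` the empty list is a default.
  lineage : ∀ {anc Z} → Forest W anc Z → V → Ancestors V
  lineage done _ = []
  lineage {anc} (node v ℓ _ _ _ F) w with w ≟ v
  ... | yes _ = (v , ℓ) ∷ anc
  ... | no _  = lineage F w
  lineage (split {D = D} _ F G) w with w ∈? D
  ... | yes _ = lineage F w
  ... | no _  = lineage G w

  second : Ancestors V → Maybe V
  second (_ ∷ (a , _) ∷ _) = just a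
  second _                 = nothing

  -- The lineage of each entry is the suffix starting at it. Hence the second entry of a lineage is
  -- a parent whose own lineage is the rest.
  data Rooted-at (g : V → Ancestors V) : Ancestors V → Set where
    []  : Rooted-at g []
    _∷_ : ∀ {a ℓ anc} → g a ≡ (a , ℓ) ∷ anc → Rooted-at g anc → Rooted-at g ((a , ℓ) ∷ anc)

  record Placed (g : V → Ancestors V) (anc : Ancestors V) (w : V) : Set where
    field
      {label} : ℕ
      {above} : Ancestors V
      is      : g w ≡ (w , label) ∷ above
      rooted  : Rooted-at g above
      anc⊆    : ∀ {x} → x ∈ anc → x ∈ above
      close   : ∀ {a ℓa} → (a , ℓa) ∈ above → E a w → Close ℓa label
      counts  : ∀ i → count i ((w , label) ∷ above) ≤ W

  -- `g` will be the lineage map of the whole forest, which that of a part matches on the vertices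
  -- of the part.
  record Agrees (g : V → Ancestors V) {anc Z} (F : Forest W anc Z) : Set where
    constructor agrees
    field at : ∀ {w} → w ∈ Z → g w ≡ lineage F w
  open Agrees

  module _ {g : V → Ancestors V} where

    agrees-root : ∀ {anc Z v ℓ} {v∈ : v ∈ Z}
                  {cl : ∀ {a ℓa} → (a , ℓa) ∈ anc → E a v → Close ℓa ℓ} {ct}
                  {F : Forest W ((v , ℓ) ∷ anc) (Z ∖ (v ∷ []))} →
                  Agrees g (node v ℓ v∈ cl ct F) → g v ≡ (v , ℓ) ∷ anc
    agrees-root {v = v} {v∈ = v∈} agree with v ≟ v | at agree v∈
    ... | yes _ | e = e
    ... | no ≢  | _ = contradiction refl ≢

    agrees-rest : ∀ {anc Z v ℓ} {v∈ : v ∈ Z}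
                  {cl : ∀ {a ℓa} → (a , ℓa) ∈ anc → E a v → Close ℓa ℓ} {ct}
                  {F : Forest W ((v , ℓ) ∷ anc) (Z ∖ (v ∷ []))} →
                  Agrees g (node v ℓ v∈ cl ct F) → Agrees g F
    agrees-rest {Z = Z} {v} {F = F} agree = agrees rest
      where
      rest : ∀ {w} → w ∈ Z ∖ (v ∷ []) → g w ≡ lineage F w
      rest {w} w∈′ with ∈-∖⁻ Z (v ∷ []) w∈′
      ... | w∈ , w∉ with w ≟ v | at agree {w} w∈
      ... | yes w≡v | _ = contradiction (here w≡v) w∉
      ... | no _    | e = e

    agrees-left : ∀ {anc Z D D′} {sp : Splits Z D D′} {F : Forest W anc D} {G : Forest W anc D′} →
                  Agrees g (split sp F G) → Agrees g F
    agrees-left {D = D} {sp = sp} {F} agree = agrees left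
      where
      left : ∀ {w} → w ∈ D → g w ≡ lineage F w
      left {w} w∈ with w ∈? D | at agree (Splits.left⊆ sp w∈)
      ... | yes _ | e = e
      ... | no ∉  | _ = contradiction w∈ ∉

    agrees-right : ∀ {anc Z D D′} {sp : Splits Z D D′} {F : Forest W anc D} {G : Forest W anc D′} →
                   Agrees g (split sp F G) → Agrees g G
    agrees-right {D = D} {D′} {sp} {G = G} agree = agrees right
      where
      right : ∀ {w} → w ∈ D′ → g w ≡ lineage G w
      right {w} w∈ with w ∈? D | at agree (Splits.right⊆ sp w∈)
      ... | yes w∈D | _ = contradiction w∈ (Splits.disjoint sp w∈D)
      ... | no _    | e = e

    placed : ∀ {anc Z} (F : Forest W anc Z) → Agrees g F → Rooted-at g anc →
             ∀ {w} → w ∈ Z → Placed g anc w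
    placed {Z = Z} F@(node v ℓ v∈ cl ct F′) agree r {w} w∈ with w ≟ v
    ... | yes refl = record
      { is = agrees-root agree; rooted = r; anc⊆ = id; close = cl; counts = ct }
    ... | no w≢v = record { Placed p; anc⊆ = Placed.anc⊆ p ∘ there }
      where p = placed F′ (agrees-rest agree) (agrees-root agree ∷ r)
                       (∈-∖⁺ w∈ λ { (here eq) → w≢v eq })
    placed (split sp F G) agree r w∈ =
      [ placed F (agrees-left agree) r , placed G (agrees-right agree) r ]′
        (Splits.cover sp w∈)

    Above : V → V → Set
    Above u w = ∃[ ℓw ] ∃[ ups ] ∃[ ℓu ] g w ≡ (w , ℓw) ∷ ups × (u , ℓu) ∈ ups

    -- One descends until an end of the edge is the vertex placed, which makes it an ancestor of the
    -- other. The ends never part at a split, as no edge crosses it.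
    comparable : ∀ {anc Z} (F : Forest W anc Z) → Agrees g F → Rooted-at g anc →
                 ∀ {u w} → u ∈ Z → w ∈ Z → E u w → Above u w ⊎ Above w u
    comparable {Z = Z} (node v ℓ v∈ cl ct F) agree r {u} {w} u∈ w∈ e with u ≟ v | w ≟ v
    ... | yes refl | yes refl = contradiction e E-irrefl
    ... | yes refl | no w≢v = inj₁ (_ , _ , _ , Placed.is p , Placed.anc⊆ p (here refl))
      where p = placed F (agrees-rest agree) (agrees-root agree ∷ r)
                       (∈-∖⁺ w∈ λ { (here eq) → w≢v eq })
    ... | no u≢v | yes refl = inj₂ (_ , _ , _ , Placed.is p , Placed.anc⊆ p (here refl))
      where p = placed F (agrees-rest agree) (agrees-root agree ∷ r)
                       (∈-∖⁺ u∈ λ { (here eq) → u≢v eq })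
    ... | no u≢v | no w≢v = comparable F (agrees-rest agree) (agrees-root agree ∷ r)
                       (∈-∖⁺ u∈ λ { (here eq) → u≢v eq }) (∈-∖⁺ w∈ λ { (here eq) → w≢v eq }) e
    comparable (split sp F G) agree r u∈ w∈ e with Splits.cover sp u∈ | Splits.cover sp w∈
    ... | inj₁ u∈D | inj₁ w∈D = comparable F (agrees-left agree) r u∈D w∈D e
    ... | inj₂ u∈D | inj₂ w∈D = comparable G (agrees-right agree) r u∈D w∈D e
    ... | inj₁ u∈D | inj₂ w∈D = contradiction e (Splits.no-edge sp u∈D w∈D)
    ... | inj₂ u∈D | inj₁ w∈D = contradiction (E-sym e) (Splits.no-edge sp w∈D u∈D)

    parent-lineage : ∀ {w ℓ u above} → Rooted-at g above → second ((w , ℓ) ∷ above) ≡ just u →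
                     g u ≡ above
    parent-lineage (eq ∷ _) refl = eq

    rooted-∈ : ∀ {a ℓ anc} → Rooted-at g anc → (a , ℓ) ∈ anc → ∃[ ups ] g a ≡ (a , ℓ) ∷ ups
    rooted-∈ (eq ∷ _) (here refl) = _ , eq
    rooted-∈ (_ ∷ r)  (there a∈)  = rooted-∈ r a∈

  first-label : Ancestors V → ℕ
  first-label ((_ , ℓ) ∷ _) = ℓ
  first-label []            = 0

  module _ (F : Forest W [] (allFin n)) where

    private
      g : V → Ancestors V
      g = lineage F

      place : ∀ w → Placed g [] w
      place w = placed F (agrees λ _ → refl) [] (∈-allFin w)

      module At w = Placed (place w)

    up-parent : V → Maybe V
    up-parent v = second (g v)

    level : V → ℕ
    level v = first-label (g v)

    level-≡ : ∀ {v ℓ ups} → g v ≡ (v , ℓ) ∷ ups → level v ≡ ℓ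
    level-≡ eq = cong first-label eq

    parent⇒lineage : ∀ {v u} → up-parent v ≡ just u → ∃[ ℓ ] g v ≡ (v , ℓ) ∷ g u
    parent⇒lineage {v} eq = _ , trans (At.is v)
      (cong ((v , At.label v) ∷_)
        (sym (parent-lineage (At.rooted v) (trans (cong second (sym (At.is v))) eq))))

    ancestor⇒above : ∀ {v w} → ProperAnc up-parent v w → Above {g} w v
    ancestor⇒above {w = w} (par eq) = let ℓ , e = parent⇒lineage eq in
      ℓ , _ , _ , e , subst ((w , At.label w) ∈_) (sym (At.is w)) (here refl)
    ancestor⇒above (up {u} eq p) with parent⇒lineage eq | ancestor⇒above p
    ... | ℓ , e | ℓu , _ , ℓw , eq′ , w∈ = ℓ , _ , ℓw , e , subst ((_ , ℓw) ∈_) (sym eq′) (there w∈)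

    -- The lineage of a parent is the tail of that of its child; this makes the parent map acyclic.
    height-< : ∀ {v w} → ProperAnc up-parent v w → length (g w) < length (g v)
    height-< (par eq)  = let _ , e = parent⇒lineage eq in ≤-reflexive (sym (cong length e))
    height-< (up eq p) = let _ , e = parent⇒lineage eq in
      <-trans (height-< p) (≤-reflexive (sym (cong length e)))

    lineage⇒ancestor : ∀ {v w ℓ ℓ′ above} → g v ≡ (v , ℓ) ∷ above → Rooted-at g above →
                       (w , ℓ′) ∈ above → ProperAnc up-parent v w
    lineage⇒ancestor eq (_ ∷ _) (here refl) = par (cong second eq)
    lineage⇒ancestor eq (eq′ ∷ r) (there w∈) = up (cong second eq) (lineage⇒ancestor eq′ r w∈)

    above⇒ancestor : ∀ {u w} → Above {g} u w → ProperAnc up-parent w u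
    above⇒ancestor {w = w} (_ , _ , _ , eq , u∈) with trans (sym (At.is w)) eq
    ... | refl = lineage⇒ancestor eq (At.rooted w) u∈

    above⇒close : ∀ {u w} → Above {g} u w → E u w → Close (level u) (level w)
    above⇒close {u} {w} (ℓw , _ , ℓu , eq , u∈) e with trans (sym (At.is w)) eq
    ... | refl = subst₂ Close (sym (level-≡ (proj₂ (rooted-∈ (At.rooted w) u∈)))) (sym (level-≡ (At.is w)))
                   (At.close w u∈ e)

    rooted-forest : RootedForest n
    rooted-forest = record { parent = up-parent; acyclic = λ v p → <-irrefl refl (height-< p) }

    on-root-path : ∀ {v w i} → OnRootPath rooted-forest v w → level w ≡ i →
                   (w , i) ∈ filter (labelled? i) (g v)
    on-root-path {v} (inj₁ refl) refl = ∈-filter⁺ (labelled? _)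
      (subst ((v , level v) ∈_) (sym (At.is v)) (here (cong (v ,_) (level-≡ (At.is v))))) refl
    on-root-path {v} {w} (inj₂ p) refl with ancestor⇒above p
    ... | _ , _ , ℓw , eq , w∈ with trans (sym (At.is v)) eq
    ... | refl = ∈-filter⁺ (labelled? _) (subst ((w , level w) ∈_) (sym (At.is v))
          (there (subst (λ ℓ → (w , ℓ) ∈ At.above v)
                        (sym (level-≡ (proj₂ (rooted-∈ (At.rooted v) w∈)))) w∈))) refl

    -- The vertices in question inject into the entries of the lineage of `v` that are labelled `i`.
    few-on-level : ∀ v i → AtMost (λ w → OnRootPath rooted-forest v w × level w ≡ i) W
    few-on-level v i f f-injective on = contradiction
      (≤-trans (injective⇒≤ {f = λ j → Any.index (mem j)} index-injective)
        (subst (λ anc → count i anc ≤ W) (sym (At.is v)) (At.counts v i)))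
      1+n≰n
      where
      mem : ∀ j → (f j , i) ∈ filter (labelled? i) (g v)
      mem j = on-root-path (proj₁ (on j)) (proj₂ (on j))
      index-injective : ∀ {j j′} → Any.index (mem j) ≡ Any.index (mem j′) → j ≡ j′
      index-injective {j} {j′} eq = f-injective (cong proj₁ (trans (lookup-index (mem j))
        (trans (cong (lookup (filter (labelled? i) (g v))) eq) (sym (lookup-index (mem j′))))))

edge? : ∀ (G : Graph) u v → Dec (Edge G u v)
edge? G u v = adj G u v Bool.≟ true

edge-sym : ∀ (G : Graph) {u v} → Edge G u v → Edge G v u
edge-sym G {u} {v} e = trans (Graph.sym G v u) e

edge-irrefl : ∀ (G : Graph) {u} → ¬ Edge G u u
edge-irrefl G {u} e with trans (sym e) (Graph.irrefl G u)
... | ()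

graph-ltd : ∀ (G : Graph) {W} → Layered.Forest (Edge G) (edge? G) (edge-sym G) W [] (allFin _) →
            LtdAtMost G W
graph-ltd G {W} F = rooted-forest F , level F
  , (λ u v e → [ inj₂ ∘ above⇒ancestor F , inj₁ ∘ above⇒ancestor F ]′ (related e))
  , (λ u v e → close-levels e (related e))
  , (λ v _ i → few-on-level F v i)
  where
  open Realise (Edge G) (edge? G) (edge-sym G) (edge-irrefl G) {W}
  related : ∀ {u v} → Edge G u v → Above {lineage F} u v ⊎ Above {lineage F} v u
  related e = comparable F (agrees λ _ → refl) [] (∈-allFin _) (∈-allFin _) e
  close-levels : ∀ {u v} → Edge G u v → Above {lineage F} u v ⊎ Above {lineage F} v u →
                 Close (level F u) (level F v)
  close-levels e (inj₁ a) = above⇒close F a e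
  close-levels e (inj₂ a) = Product.swap (above⇒close F a (edge-sym G e))

-- Models of fans

allPairs-lookup : ∀ {A : Set} {R : A → A → Set} → (∀ {x y} → R x y → R y x) → ∀ {xs} → AllPairs R xs →
                  ∀ {i j} → i ≢ j → R (lookup xs i) (lookup xs j)
allPairs-lookup s (_ ∷ _) {zero}  {zero}  i≢j = contradiction refl i≢j
allPairs-lookup s (h ∷ _) {zero}  {suc j} _   = All.lookup h (∈-lookup j)
allPairs-lookup s (h ∷ _) {suc i} {zero}  _   = s (All.lookup h (∈-lookup i))
allPairs-lookup s (_ ∷ p) {suc i} {suc j} i≢j = allPairs-lookup s p (i≢j ∘ cong suc)

linked-lookup : ∀ {A : Set} {R : A → A → Set} {xs} → Linked R xs →
                ∀ {i j} → suc (toℕ i) ≡ toℕ j → R (lookup xs i) (lookup xs j)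
linked-lookup (r ∷ _) {zero}  {suc zero} _  = r
linked-lookup (_ ∷ l) {suc i} {suc j}    eq = linked-lookup l (suc-injective eq)

injective-missing⇒≤ : ∀ {m s} {σ : Fin m → Fin s} {v} → Injective _≡_ _≡_ σ → (∀ i → σ i ≢ v) →
                      m ≤ s ∸ 1
injective-missing⇒≤ {s = suc _} inj miss = injective⇒≤
  (λ {i} {j} eq → inj (punchOut-injective (miss i ∘ sym) (miss j ∘ sym) eq))

-- `X` as a subgraph of a path with a centre joined to all of it, a form common to both cases of
-- `IsFan`.
record Fan (X : Graph) : Set where
  field
    centre      : Fin (size X)
    {m}         : ℕ
    rim         : Fin m → Fin (size X)
    m≤          : m ≤ size X ∸ 1
    covers      : ∀ x → x ≢ centre → ∃[ i ] rim i ≡ x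
    consecutive : ∀ i j → Edge X (rim i) (rim j) → suc (toℕ i) ≡ toℕ j ⊎ suc (toℕ j) ≡ toℕ i

fan : ∀ X → IsFan X → 3 ≤ size X → Fan X
fan X (inj₁ (zero , σ , _ , _ , onto , _)) 3≤ with onto (fromℕ< 3≤) _
... | () , _
-- If `X` is itself a path, its first vertex serves as the centre.
fan X (inj₁ (suc m , σ , inj , _ , onto , edges)) _ = record
  { centre = σ zero; rim = σ ∘ suc
  ; m≤ = injective-missing⇒≤ {v = σ zero} (Fin.suc-injective ∘ inj) (λ i eq → case inj eq of λ ())
  ; covers = λ x x≢ → case onto x _ of λ
      { (zero , eq) → contradiction (sym eq) x≢ ; (suc i , eq) → i , eq }
  ; consecutive = λ i j e → Sum.map suc-injective suc-injective (proj₁ (edges (suc i) (suc j)) e) }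
fan X (inj₂ (v , m , σ , inj , avoids , onto , edges)) _ = record
  { centre = v; rim = σ; m≤ = injective-missing⇒≤ inj avoids; covers = onto
  ; consecutive = λ i j → proj₁ (edges i j) }

module _ (G : Graph) where

  open Chains (Edge G) (edge-sym G)
  open Chain

  walk⇒reach : ∀ {P : VSet G} {u w v} → Reach G P u w → Walk (Edge G) P w v → Reach G P u v
  walk⇒reach r (stop _)   = r
  walk⇒reach r (go _ e w) = walk⇒reach (step r (walk-head w) e) w

  conn⇒reach : ∀ {xs} → Conn xs → ∀ u v → u ∈ xs → v ∈ xs → Reach G (_∈ xs) u v
  conn⇒reach c u v u∈ v∈ = walk⇒reach (here u∈) (c u∈ v∈)

  -- `U` is the branch set of the centre, and the branches of the chain are those of the rim in
  -- order. Roots lie in `S` and so have neighbours in `U`; linked branches provide the rim edges.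
  fan-model : ∀ {X} (Φ : Fan X) {U D S bs} → Conn U → Disj U D →
              (∀ {v} → v ∈ S → ∃[ u ] u ∈ U × Edge G u v) →
              Chain S D bs → size X ∸ 1 ≤ length bs → 2 ≤ size X → Model X G
  fan-model {X} Φ {U} {D} {S} {bs} conU U#D S⁻ Bs long 2≤ = record
    { branch = λ x v → v ∈ part x
    ; disjoint = λ x y x≢y v → apart x y x≢y
    ; nonempty = filled
    ; connected = λ x → conn⇒reach (part-conn x)
    ; edges = touch }
    where
    open Fan Φ
    at : Fin m → Fin (length bs)
    at i = inject≤ i (≤-trans m≤ long)
    spoke : Fin m → List (Fin (size G))
    spoke i = lookup bs (at i)
    spoke-branch : ∀ i → Branch S D (spoke i)
    spoke-branch i = All.lookup (branches Bs) (∈-lookup (at i))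
    part : Fin (size X) → List (Fin (size G))
    part x with x ≟ centre
    ... | yes _ = U
    ... | no x≢ = spoke (proj₁ (covers x x≢))
    part-conn : ∀ x → Conn (part x)
    part-conn x with x ≟ centre
    ... | yes _ = conU
    ... | no x≢ = Branch.conn (spoke-branch _)
    hub : ∀ i → ∃[ u ] u ∈ U × Edge G u (Branch.root (spoke-branch i))
    hub i = S⁻ (Branch.root∈S (spoke-branch i))
    filled : ∀ x → ∃[ v ] v ∈ part x
    filled x with x ≟ centre
    ... | no x≢ = _ , Branch.root∈ (spoke-branch _)
    -- `U` is non-empty because the root of the first branch has a neighbour there; a first branch
    -- exists as `X` has at least two vertices.
    ... | yes _ = let u , u∈ , _ = S⁻ (Branch.root∈S (All.lookup (branches Bs) (∈-lookup first))) in u , u∈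
      where
      first : Fin (length bs)
      first = fromℕ< (≤-trans (∸-monoˡ-≤ 1 2≤) long)
    apart : ∀ x y → x ≢ y → ∀ {v} → v ∈ part x → v ∈ part y → ⊥
    apart x y x≢y v∈ v∈′ with x ≟ centre | y ≟ centre
    ... | yes refl | yes refl = x≢y refl
    ... | yes _ | no _ = U#D v∈ (Branch.within (spoke-branch _) v∈′)
    ... | no _ | yes _ = U#D v∈′ (Branch.within (spoke-branch _) v∈)
    ... | no x≢ | no y≢ = allPairs-lookup disj-sym (disjoint Bs)
        (λ eq → x≢y (same (inject≤-injective _ _ _ _ eq))) v∈ v∈′
      where
      same : proj₁ (covers x x≢) ≡ proj₁ (covers y y≢) → x ≡ y
      same eq = trans (sym (proj₂ (covers x x≢))) (trans (cong rim eq) (proj₂ (covers y y≢)))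
    touch : ∀ x y → Edge X x y → Adj (part x) (part y)
    touch x y e with x ≟ centre | y ≟ centre
    ... | yes refl | yes refl = contradiction (trans (sym e) (Graph.irrefl X x)) λ ()
    ... | yes _ | no _ = let u , u∈ , e′ = hub _ in u , _ , u∈ , Branch.root∈ (spoke-branch _) , e′
    ... | no _ | yes _ = let u , u∈ , e′ = hub _ in _ , u , Branch.root∈ (spoke-branch _) , u∈ , edge-sym G e′
    ... | no x≢ | no y≢ with covers x x≢ | covers y y≢
    ... | i , refl | j , refl = [ linked-lookup (linked Bs) ∘ positions
                                , adj-sym ∘ linked-lookup (linked Bs) ∘ positions ]′ (consecutive i j e)
      where
      positions : ∀ {i j} → suc (toℕ i) ≡ toℕ j → suc (toℕ (at i)) ≡ toℕ (at j)
      positions {i} {j} eq = trans (cong suc (Fin.toℕ-inject≤ i _)) (trans eq (sym (Fin.toℕ-inject≤ j _)))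

-- The bound as a binomial coefficient

triangle-C : ∀ k → triangle k ≡ suc k C 2
triangle-C zero    = refl
triangle-C (suc k) = trans (cong₂ _+_ (sym (nC1≡n (suc k))) (triangle-C k))
                           (nCk+nC[k+1]≡[n+1]C[k+1] (suc k) 1)

theorem1p2 : (X : Graph) → IsFan X → 3 ≤ size X →
    (G : Graph) → MinorFree X G → LtdAtMost G ((size X ∸ 1) C 2)
theorem1p2 X isFan 3≤ G free = subst (LtdAtMost G) bound (graph-ltd G
  -- With `k = size X ∸ 3` the excluded chains have `size X ∸ 1` branches, enough for the rim, and
  -- the width is `triangle (suc (size X ∸ 3))`.
  (Layered.forest (Edge G) (edge? G) (edge-sym G) (size X ∸ 3)
    (λ conU U#D S⁻ Bs long → free (fan-model G (fan X isFan 3≤) conU U#D S⁻ Bs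
      (≤-trans (≤-reflexive (size≡ 3≤)) long) (≤-trans (n≤1+n 2) 3≤)))
    (allFin _)))
  where
  size≡ : ∀ {s} → 3 ≤ s → s ∸ 1 ≡ suc (suc (s ∸ 3))
  size≡ (s≤s (s≤s (s≤s _))) = refl
  bound : triangle (suc (size X ∸ 3)) ≡ (size X ∸ 1) C 2
  bound = trans (triangle-C (suc (size X ∸ 3))) (cong (_C 2) (sym (size≡ 3≤)))
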